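{- Let $\mathcal{M}_\pi$ and $\mathcal{M}_\mu$ be two positroids on $[n]$ without loops or coloops, with associated (fixed-point-free) decorated permutations $\pi$ and $\mu$ respectively, such that $\operatorname{rk}(\mathcal{M}_\mu)<\operatorname{rk}(\mathcal{M}_\pi)$. If $\mathcal{M}_\pi$ and $\mathcal{M}_\mu$ are concordant, then every CCW-arrow of $\mu$ is covered by CCW-arrows of $\pi$.
   Context: A positroid of rank $d$ on $[n]=\{1,\dots,n\}$ is a matroid whose bases are the column sets of the nonzero maximal minors of some real $d\times n$ matrix of rank $d$ all of whose maximal minors are nonnegative. The cyclically shifted order $<_i$ on $[n]$ is $i<_i i+1<_i\cdots<_i n<_i 1<_i\cdots<_i i-1$. For $a,b\in[n]$ the cyclic interval is $[a,b]=\{x\in[n]: x\le_a b\}$ (nonempty; $[a,a-1]=[n]$, indices mod $n$). Decorated permutation of a loopless and coloopless positroid $\mathcal{M}$ with rank function $\operatorname{rk}$: it is the permutation $\pi$ of $[n]$ (without fixed points) for which $\pi(i)$ is the first element $j$ in the list $i+1,i+2,\dots,i-1$ (cyclically) such that $\operatorname{rk}(\{i,i+1,\dots,j\})=\operatorname{rk}(\{i+1,\dots,j\})$. A CCW-arrow of a permutation $\sigma$ is a cyclic interval of the form $[x,\sigma^{ -1}(x)]$, $x\in[n]$. A set $S\subseteq[n]$ is covered by CCW-arrows of $\sigma$ if each element of $S$ is contained in some CCW-arrow of $\sigma$ that is itself contained in $S$. Two matroids on $[n]$ of different ranks $r<r'$ are concordant if they can be realized by the same matrix, i.e. there is a real $r'\times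 n$ matrix of rank $r'$ whose column matroid (bases = column sets of nonzero maximal minors) is the matroid of rank $r'$, and such that the submatrix formed by its first $r$ rows has rank $r$ and has the matroid of rank $r$ as its column matroid. -}

module Defs where

open import Algebra.Bundles using (CommutativeRing; Semiring)
import Algebra.Definitions.RawMonoid as RawMonoidDefs
import Algebra.Definitions.RawSemiring as RawSemiringDefs
open import Data.Bool.Base using (if_then_else_)
open import Data.Fin.Base as Fin using (Fin; zero; suc; toℕ; punchIn; inject≤)
open import Data.Fin.Permutation using (Permutation′; _⟨$⟩ʳ_; _⟨$⟩ˡ_)
open import Data.Fin.Subset
  using (Subset; inside; outside; _∈_; _∉_; _⊆_; _∩_; _∪_; _-_; ∣_∣; ⁅_⁆; ⊤)
open import Data.List.Base as List using (List; _++_)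
open import Data.List.Extrema.Nat using (max)
open import Data.Nat.Base as ℕ using (ℕ; zero; suc)
open import Data.Nat.DivMod using (_mod_)
import Data.Nat.Properties as ℕₚ
open import Data.Product.Base using (Σ-syntax; ∃-syntax; _×_)
open import Data.Vec.Base as Vec using (Vec; []; _∷_; lookup; tabulate)
open import Function.Bundles using (_⇔_)
open import Level using (Level; _⊔_; 0ℓ) renaming (suc to lsuc)
open import Relation.Binary.Core using (Rel)
import Relation.Binary.Construct.StrictToNonStrict as StrictToNonStrict
open import Relation.Binary.PropositionalEquality.Core using (_≡_; _≢_)
open import Relation.Binary.Structures using (IsStrictTotalOrder)
open import Relation.Nullary.Decidable.Core using (does)
open import Relation.Nullary.Negation.Core using (¬_)
open import Relation.Unary using (Pred; Decidable)

-- The field of real numbers, given by its classical axioms: a Dedekind-complete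
-- totally ordered field.  These determine it up to unique isomorphism.
record Reals (c ℓ : Level) : Set (lsuc (c ⊔ ℓ)) where
  field
    commutativeRing : CommutativeRing c ℓ

  open CommutativeRing commutativeRing public

  infix 4 _<_
  field
    _<_                : Rel Carrier ℓ
    isStrictTotalOrder : IsStrictTotalOrder _≈_ _<_
    0<1                : 0# < 1#
    +-monoʳ-<          : ∀ x {y z} → y < z → x + y < x + z
    *-pos              : ∀ {x y} → 0# < x → 0# < y → 0# < x * y
    inverse            : ∀ x → ¬ x ≈ 0# → ∃[ y ] x * y ≈ 1#

  open StrictToNonStrict _≈_ _<_ public using (_≤_)

  UpperBound : Pred Carrier ℓ → Pred Carrier (c ⊔ ℓ)
  UpperBound P u = ∀ x → P x → x ≤ u

  field
    supremum : ∀ (P : Pred Carrier ℓ) → (∃[ x ] P x) → (∃[ u ] UpperBound P u) →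
               ∃[ s ] (UpperBound P s × (∀ u → UpperBound P u → s ≤ u))

  open RawMonoidDefs +-rawMonoid public using (sum)
  open RawSemiringDefs (Semiring.rawSemiring semiring) public using (_^_)

-- Decidability of being a basis is automatic classically, a matroid on a finite
-- set having finitely many subsets; it lets the rank be computed as a number.
record Matroid (n : ℕ) : Set₁ where
  field
    Basis    : Pred (Subset n) 0ℓ
    basis?   : Decidable Basis
    nonempty : ∃[ B ] Basis B
    exchange : ∀ {B₁ B₂} → Basis B₁ → Basis B₂ → ∀ {x} → x ∈ B₁ → x ∉ B₂ →
               ∃[ y ] y ∈ B₂ × y ∉ B₁ × Basis ((B₁ - x) ∪ ⁅ y ⁆)

allSubsets : ∀ n → List (Subset n)
allSubsets zero    = List.[ [] ]
allSubsets (suc n) = List.map (inside ∷_) (allSubsets n) ++ List.map (outside ∷_) (allSubsets n)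

module _ {n : ℕ} (M : Matroid n) where
  open Matroid M

  -- rk S is the maximum of |B ∩ S| over all bases B, i.e. the size of a largest
  -- independent subset of S.
  rk : Subset n → ℕ
  rk S = max 0 (List.map (λ B → ∣ B ∩ S ∣) (List.filter basis? (allSubsets n)))

  rank : ℕ
  rank = rk ⊤

  Loop : Pred (Fin n) 0ℓ
  Loop i = ∀ B → Basis B → i ∉ B

  Coloop : Pred (Fin n) 0ℓ
  Coloop i = ∀ B → Basis B → i ∈ B

  Loopless : Set
  Loopless = ∀ i → ¬ Loop i

  Coloopless : Set
  Coloopless = ∀ i → ¬ Coloop i

-- The ground set [n] is Fin n, labelled 0 , … , n - 1 rather than 1 , … , n; this is
-- the cyclic successor i + 1.
next : ∀ {n} → Fin n → Fin n
next {suc n} i = suc (toℕ i) mod suc n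

-- The position of x in the list  a , a + 1 , … , n - 1 , 0 , … , a - 1.
position : ∀ {n} → Fin n → Fin n → ℕ
position {n} a x =
  if does (toℕ a ℕₚ.≤? toℕ x) then toℕ x ℕ.∸ toℕ a else (n ℕ.∸ toℕ a) ℕ.+ toℕ x

infix 4 _<[_]_

-- The cyclically shifted order starting at a.
_<[_]_ : ∀ {n} → Fin n → Fin n → Fin n → Set
x <[ a ] y = position a x ℕ.< position a y

-- {x | x = b or x <[ a ] b}; in particular [ a , a - 1 ] is everything.
[_,_] : ∀ {n} → Fin n → Fin n → Subset n
[ a , b ] = tabulate (λ x → does (position a x ℕₚ.≤? position a b))

-- For k ≢ i the set {i+1, …, k} is the cyclic interval [ next i , k ], and the
-- list i+1 , … , i-1 consists of the k ≢ i in the order _<[ i ]_.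
record IsDecoratedPermutation {n} (M : Matroid n) (π : Permutation′ n) : Set where
  field
    noFixedPoint : ∀ i → π ⟨$⟩ʳ i ≢ i
    rk-equal     : ∀ i → rk M [ i , π ⟨$⟩ʳ i ] ≡ rk M [ next i , π ⟨$⟩ʳ i ]
    first        : ∀ i k → k ≢ i → k <[ i ] (π ⟨$⟩ʳ i) →
                   rk M [ i , k ] ≢ rk M [ next i , k ]

CCWArrow : ∀ {n} → Permutation′ n → Pred (Subset n) 0ℓ
CCWArrow σ S = ∃[ x ] S ≡ [ x , σ ⟨$⟩ˡ x ]

CoveredByCCWArrows : ∀ {n} → Permutation′ n → Pred (Subset n) 0ℓ
CoveredByCCWArrows σ S = ∀ e → e ∈ S → ∃[ A ] CCWArrow σ A × e ∈ A × A ⊆ S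

-- The elements of S in increasing order.
elements : ∀ {n} (S : Subset n) → Vec (Fin n) ∣ S ∣
elements []            = []
elements (inside  ∷ S) = zero ∷ Vec.map suc (elements S)
elements (outside ∷ S) = Vec.map suc (elements S)

module _ {c ℓ} (ℝ : Reals c ℓ) where
  open Reals ℝ hiding (zero; _-_)

  Matrix : ℕ → ℕ → Set c
  Matrix d n = Fin d → Fin n → Carrier

  -- Laplace expansion along the first row.
  det : ∀ {d} → Matrix d d → Carrier
  det {zero}  A = 1#
  det {suc d} A =
    sum (λ j → ((- 1#) ^ toℕ j) * (A zero j * det (λ i k → A (suc i) (punchIn j k))))

  maximalMinor : ∀ {d n} → Matrix d n → (S : Subset n) → d ≡ ∣ S ∣ → Carrier
  maximalMinor A S d≡∣S∣ = det (λ i k → A i (lookup (elements S) (Fin.cast d≡∣S∣ k)))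

  IndependentColumns : ∀ {d n} → Matrix d n → Pred (Subset n) (c ⊔ ℓ)
  IndependentColumns {n = n} A S =
    ∀ (t : Fin n → Carrier) → (∀ j → j ∉ S → t j ≈ 0#) →
    (∀ i → sum (λ j → t j * A i j) ≈ 0#) → ∀ j → t j ≈ 0#

  HasRank : ∀ {d n} → Matrix d n → ℕ → Set (c ⊔ ℓ)
  HasRank A r = (∃[ S ] IndependentColumns A S × ∣ S ∣ ≡ r)
              × (∀ S → IndependentColumns A S → ∣ S ∣ ℕ.≤ r)

  IsColumnMatroid : ∀ {d n} → Matrix d n → Matroid n → Set ℓ
  IsColumnMatroid {d} A M =
    ∀ S → Matroid.Basis M S ⇔ (Σ[ e ∈ d ≡ ∣ S ∣ ] ¬ maximalMinor A S e ≈ 0#)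

  NonnegativeMaximalMinors : ∀ {d n} → Matrix d n → Set ℓ
  NonnegativeMaximalMinors {d} A = ∀ S (e : d ≡ ∣ S ∣) → 0# ≤ maximalMinor A S e

  IsPositroid : ∀ {n} → Matroid n → Set (c ⊔ ℓ)
  IsPositroid {n} M =
    ∃[ A ] HasRank {rank M} {n} A (rank M) × NonnegativeMaximalMinors A × IsColumnMatroid A M

  firstRows : ∀ {r d n} → r ℕ.≤ d → Matrix d n → Matrix r n
  firstRows r≤d A i = A (inject≤ i r≤d)

  Concordant : ∀ {n} (M N : Matroid n) → rank M ℕ.< rank N → Set (c ⊔ ℓ)
  Concordant {n} M N r<r′ =
    Σ[ A ∈ Matrix (rank N) n ]
      let A₀ = firstRows (ℕₚ.<⇒≤ r<r′) A in
      HasRank A (rank N) × IsColumnMatroid A N ×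
      HasRank A₀ (rank M) × IsColumnMatroid A₀ M

{-# OPTIONS --safe #-}

-- Write C ⊢ e when e lies in the closure of C, i.e. rk (C ∪ e) = rk C; for the column matroid
-- of A and e ∉ C this says that some linear relation among the columns is supported on C ∪ e
-- and involves e.  A relation of A is also a relation of its first rows, so C ⊢ e in Mπ
-- implies C ⊢ e in Mμ.
--
-- Let [ x , y ] be an arrow of μ and C its complement.  Then y is not in the closure of C in
-- Mμ but is in that of C ∪ x.  If some e strictly between x and y were in the closure of C,
-- then e, not being a loop, would be parallel to some f ∈ C modulo an independent set, and
-- exchanging e for f in two minors, one using x and one using y, would give a negative maximal
-- minor, because the chords {x, y} and {e, f} cross.  So C ⊬ e in Mμ and hence in Mπ, for all
-- e ∈ [ x , y ].  Now let b be the last element of [ e , y ] such that [ b , x - 1 ] ⊢ e in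
-- Mπ.  By exchange b is in the closure of [ b + 1 , e ] but not in that of [ b + 1 , x - 1 ],
-- so π b ∈ [ x , e ] and [ π b , b ] is an arrow of π containing e and contained in [ x , y ].
--
-- The minors enter through the exterior algebra: they are the coefficients of the wedge of the
-- rows of A, and contraction with a relation is an antiderivation killing every row, hence
-- this wedge.

module Submission where

open import Algebra.Bundles using (CommutativeRing; Semiring)
import Algebra.Properties.CommutativeSemigroup as CommutativeSemigroupProperties
open import Data.Bool.Base using (true; false; _∧_)
import Data.Bool.Properties as Bool
open import Data.Empty using (⊥)
open import Data.Fin.Base as Fin using (Fin; zero; suc; toℕ; fromℕ<; punchIn)
open import Data.Fin.Permutation using (Permutation′; _⟨$⟩ʳ_; _⟨$⟩ˡ_; inverseˡ; inverseʳ)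
import Data.Fin.Properties as Fin
open import Data.Fin.Subset using (Subset; inside; outside; ∣_∣; _∩_; _∈_; _⊆_)
open import Data.List.Base as List using (List)
open import Data.List.Extrema.Nat using (xs≤max; argmax-sel)
import Data.List.Membership.Propositional as List
open import Data.List.Membership.Propositional.Properties
  using (∈-map⁺; ∈-map⁻; ∈-++⁺ˡ; ∈-++⁺ʳ; ∈-filter⁺; ∈-filter⁻)
import Data.List.Relation.Unary.All as All
open import Data.List.Relation.Unary.Any using (here)
open import Data.Nat.Base as ℕ using (ℕ; zero; suc)
open import Data.Nat.DivMod using (_%_; m<n⇒m%n≡m; n%n≡0)
open import Data.Nat.Properties as ℕₚ using (module ≤-Reasoning)
open import Data.Product.Base using (∃-syntax; _×_; _,_; proj₁; proj₂)
open import Data.Sign.Base as Sign using (Sign)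
import Data.Sign.Properties as Sign
open import Data.Sum.Base using (_⊎_; inj₁; inj₂)
open import Data.Vec.Base as Vec using ([]; _∷_; lookup; tabulate; _[_]≔_)
open import Data.Vec.Functional using (updateAt)
open import Data.Vec.Functional.Properties using (updateAt-updates; updateAt-minimal)
open import Data.Vec.Properties
  using (lookup-map; lookup-zipWith; lookup∘update; lookup∘update′; []≔-idempotent; []≔-commutes;
         []≔-lookup; lookup⇒[]=; []=⇒lookup; lookup∘tabulate; tabulate∘lookup; tabulate-cong)
open import Defs
open import Function.Base using (_∘_; _∘′_; const; id)
open import Function.Bundles using (module Equivalence)
open import Level using (Level; 0ℓ)
open import Relation.Binary.PropositionalEquality
  using (_≡_; _≢_; refl; sym; trans; cong; cong₂; subst; subst₂; module ≡-Reasoning)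
open import Relation.Binary.Structures using (IsStrictTotalOrder)
open import Relation.Nullary using (¬_; Dec; does; yes; no; ofʸ; ofⁿ; contradiction)
open import Relation.Nullary.Decidable using (dec-true; dec-false; decidable-stable)
open import Relation.Unary using (Pred; Decidable)

-- Maximal minors as coefficients of the wedge of the rows

removeAt : ∀ {n} (S : Subset n) → Fin ∣ S ∣ → Subset n
removeAt (outside ∷ S) j       = outside ∷ removeAt S j
removeAt (inside ∷ S)  zero    = outside ∷ S
removeAt (inside ∷ S)  (suc j) = inside ∷ removeAt S j

size-removeAt : ∀ {n} (S : Subset n) j → suc ∣ removeAt S j ∣ ≡ ∣ S ∣
size-removeAt (outside ∷ S) j       = size-removeAt S j
size-removeAt (inside ∷ S)  zero    = refl
size-removeAt (inside ∷ S)  (suc j) = cong suc (size-removeAt S j)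

-- `punchIn` skips exactly the element deleted by `removeAt`, so the submatrices in the expansion of
-- `det` are again column selections by subsets. The casts arise because `det` counts columns by `d`
-- and `elements` by the size of `S`.
elements-removeAt : ∀ {d n} (S : Subset n) (e : suc d ≡ ∣ S ∣) j (e′ : d ≡ ∣ removeAt S (Fin.cast e j) ∣)
  k → lookup (elements (removeAt S (Fin.cast e j))) (Fin.cast e′ k) ≡
  lookup (elements S) (Fin.cast e (punchIn j k))
elements-removeAt (outside ∷ S) e j e′ k = begin
  lookup (Vec.map suc (elements (removeAt S (Fin.cast e j)))) (Fin.cast e′ k)
    ≡⟨ lookup-map (Fin.cast e′ k) suc (elements (removeAt S (Fin.cast e j))) ⟩
  suc (lookup (elements (removeAt S (Fin.cast e j))) (Fin.cast e′ k))
    ≡⟨ cong suc (elements-removeAt S e j e′ k) ⟩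
  suc (lookup (elements S) (Fin.cast e (punchIn j k)))
    ≡⟨ lookup-map (Fin.cast e (punchIn j k)) suc (elements S) ⟨
  lookup (Vec.map suc (elements S)) (Fin.cast e (punchIn j k)) ∎
  where open ≡-Reasoning
elements-removeAt (inside ∷ S) e zero    e′ k       = refl
elements-removeAt (inside ∷ S) e (suc j) e′ zero    = refl
elements-removeAt {suc d} (inside ∷ S) e (suc j) e′ (suc k) = begin
  lookup (Vec.map suc (elements (removeAt S _))) _
    ≡⟨ lookup-map _ suc (elements (removeAt S _)) ⟩
  suc (lookup (elements (removeAt S _)) _)
    ≡⟨ cong suc (elements-removeAt S (ℕₚ.suc-injective e) j (ℕₚ.suc-injective e′) k) ⟩
  suc (lookup (elements S) _)
    ≡⟨ lookup-map _ suc (elements S) ⟨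
  lookup (Vec.map suc (elements S)) _ ∎
  where open ≡-Reasoning

-- The sign with which j enters the ordered set S: the parity of the elements below j.
position-sign : ∀ {n} → Subset n → Fin n → Sign
position-sign (_ ∷ S)       zero    = Sign.+
position-sign (outside ∷ S) (suc j) = position-sign S j
position-sign (inside ∷ S)  (suc j) = Sign.opposite (position-sign S j)

module Forms {c ℓ} (R : CommutativeRing c ℓ) where
  open CommutativeRing R hiding (zero; refl; sym; trans)
  private module ≈ = CommutativeRing R using (refl; sym; trans)
  open import Algebra.Definitions.RawMonoid +-rawMonoid using (sum)
  open import Algebra.Definitions.RawSemiring (Semiring.rawSemiring semiring) using (_^_)
  open import Algebra.Properties.Ring ring
  open import Algebra.Properties.Semiring.Sum semiring using (*-distribˡ-sum)
  open import Algebra.Properties.Monoid.Sum +-monoid using (sum-cong-≋)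
  open import Algebra.Solver.Ring.NaturalCoefficients.Default commutativeSemiring
  open import Relation.Binary.Reasoning.Setoid setoid

  -- An element of the exterior algebra on `n` generators, given by its coefficients at the
  -- increasing monomials; all degrees are kept together.
  Form : ℕ → Set c
  Form n = Subset n → Carrier

  Vector : ℕ → Set c
  Vector n = Fin n → Carrier

  infix 8 _·_
  _·_ : ∀ {n} → Vector n → Vector n → Carrier
  t · a = sum (λ j → t j * a j)

  -- Left multiplication by `a`. The minus sign is the cost of moving a later generator past the
  -- first one.
  wedge : ∀ {n} → Vector n → Form n → Form n
  wedge a ω []            = 0#
  wedge a ω (outside ∷ S) = wedge (a ∘ suc) (ω ∘ (outside ∷_)) S
  wedge a ω (inside ∷ S)  = a zero * ω (outside ∷ S) - wedge (a ∘ suc) (ω ∘ (inside ∷_)) S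

  -- Interior product with `t`: the coefficient at `S` sums `t j` times the coefficient at `S` with
  -- `j` added, over `j` outside `S`, each with the sign by which `j` enters `S`.
  contract : ∀ {n} → Vector n → Form n → Form n
  contract t ω []            = 0#
  contract t ω (outside ∷ S) = t zero * ω (inside ∷ S) + contract (t ∘ suc) (ω ∘ (outside ∷_)) S
  contract t ω (inside ∷ S)  = - contract (t ∘ suc) (ω ∘ (inside ∷_)) S

  wedge-cong : ∀ {n} a {ω η : Form n} → (∀ S → ω S ≈ η S) → ∀ S → wedge a ω S ≈ wedge a η S
  wedge-cong a ω≈η []            = ≈.refl
  wedge-cong a ω≈η (outside ∷ S) = wedge-cong _ (ω≈η ∘ (outside ∷_)) S
  wedge-cong a ω≈η (inside ∷ S)  =
    +-cong (*-congˡ (ω≈η (outside ∷ S))) (-‿cong (wedge-cong _ (ω≈η ∘ (inside ∷_)) S))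

  -- The combination has the shape that `contract` takes on sets avoiding the first generator;
  -- `contract-linear` likewise has the shape of `wedge` on sets containing it.
  wedge-linear : ∀ {n} a x (ω η : Form n) S →
                 wedge a (λ T → x * ω T + η T) S ≈ x * wedge a ω S + wedge a η S
  wedge-linear a x ω η []            = ≈.sym (≈.trans (+-identityʳ _) (zeroʳ x))
  wedge-linear a x ω η (outside ∷ S) = wedge-linear _ x (ω ∘ (outside ∷_)) (η ∘ (outside ∷_)) S
  wedge-linear a x ω η (inside ∷ S)  = begin
    a₀ * (x * o + p) - wedge _ _ S
      ≈⟨ +-congˡ (-‿cong (wedge-linear _ x (ω ∘ (inside ∷_)) (η ∘ (inside ∷_)) S)) ⟩
    a₀ * (x * o + p) - (x * u + v)
      ≈⟨ +-congˡ (≈.trans (≈.sym (-‿+-comm _ _)) (+-congʳ (-‿distribʳ-* x u))) ⟩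
    a₀ * (x * o + p) + (x * (- u) + - v)
      ≈⟨ solve 6 (λ a x o p u v → a :* (x :* o :+ p) :+ (x :* u :+ v) :=
                                  x :* (a :* o :+ u) :+ (a :* p :+ v)) ≈.refl a₀ x o p (- u) (- v) ⟩
    x * (a₀ * o - u) + (a₀ * p - v) ∎
    where
    a₀ = a zero
    o = ω (outside ∷ S)
    p = η (outside ∷ S)
    u = wedge (a ∘ suc) (ω ∘ (inside ∷_)) S
    v = wedge (a ∘ suc) (η ∘ (inside ∷_)) S

  wedge-zero : ∀ {n} a {ω : Form n} → (∀ S → ω S ≈ 0#) → ∀ S → wedge a ω S ≈ 0#
  wedge-zero a ω≈0 []            = ≈.refl
  wedge-zero a ω≈0 (outside ∷ S) = wedge-zero _ (ω≈0 ∘ (outside ∷_)) S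
  wedge-zero a ω≈0 (inside ∷ S)  =
    ≈.trans (+-cong (≈.trans (*-congˡ (ω≈0 (outside ∷ S))) (zeroʳ _))
                  (≈.trans (-‿cong (wedge-zero _ (ω≈0 ∘ (inside ∷_)) S)) -0#≈0#))
          (+-identityʳ 0#)

  wedge-neg : ∀ {n} a (ω : Form n) S → wedge a (λ T → - ω T) S ≈ - wedge a ω S
  wedge-neg a ω []            = ≈.sym -0#≈0#
  wedge-neg a ω (outside ∷ S) = wedge-neg _ (ω ∘ (outside ∷_)) S
  wedge-neg a ω (inside ∷ S)  =
    ≈.trans (+-cong (≈.sym (-‿distribʳ-* _ _)) (-‿cong (wedge-neg _ (ω ∘ (inside ∷_)) S)))
          (-‿+-comm _ _)

  contract-linear : ∀ {n} t x (ω η : Form n) S →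
                    contract t (λ T → x * ω T - η T) S ≈ x * contract t ω S - contract t η S
  contract-linear t x ω η [] = ≈.sym (≈.trans (+-cong (zeroʳ x) -0#≈0#) (+-identityʳ 0#))
  contract-linear t x ω η (outside ∷ S) = begin
    t₀ * (x * o + - p) + contract _ _ S
      ≈⟨ +-congˡ (contract-linear _ x (ω ∘ (outside ∷_)) (η ∘ (outside ∷_)) S) ⟩
    t₀ * (x * o + - p) + (x * u + - v)
      ≈⟨ solve 6 (λ t x o p u v → t :* (x :* o :+ p) :+ (x :* u :+ v) :=
                                  x :* (t :* o :+ u) :+ (t :* p :+ v)) ≈.refl t₀ x o (- p) u (- v) ⟩
    x * (t₀ * o + u) + (t₀ * (- p) + - v)
      ≈⟨ +-congˡ (≈.trans (+-congʳ (≈.sym (-‿distribʳ-* t₀ p))) (-‿+-comm _ _)) ⟩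
    x * (t₀ * o + u) - (t₀ * p + v) ∎
    where
    t₀ = t zero
    o = ω (inside ∷ S)
    p = η (inside ∷ S)
    u = contract (t ∘ suc) (ω ∘ (outside ∷_)) S
    v = contract (t ∘ suc) (η ∘ (outside ∷_)) S
  contract-linear t x ω η (inside ∷ S) =
    ≈.trans (-‿cong (contract-linear _ x (ω ∘ (inside ∷_)) (η ∘ (inside ∷_)) S))
          (≈.trans (≈.sym (-‿+-comm _ _)) (+-congʳ (-‿distribʳ-* x _)))

  -- The antiderivation rule, by induction on the ground set: the cross terms through the first
  -- generator cancel, leaving the product of the first entries and the rule for the tails.
  contract-wedge : ∀ {n} (t a : Vector n) (ω : Form n) S →
    contract t (wedge a ω) S + wedge a (contract t ω) S ≈ t · a * ω S
  contract-wedge t a ω [] = ≈.trans (+-identityʳ 0#) (≈.sym (zeroˡ _))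
  contract-wedge t a ω (outside ∷ S) = begin
    (t₀ * (a₀ * w + - u) + v) + wedge _ (contract t ω ∘ (outside ∷_)) S
      ≈⟨ +-congˡ (wedge-linear a′ t₀ (ω ∘ (inside ∷_)) (contract t′ (ω ∘ (outside ∷_))) S) ⟩
    (t₀ * (a₀ * w + - u) + v) + (t₀ * u + v′)
      ≈⟨ solve 7 (λ t a w n v u v′ → (t :* (a :* w :+ n) :+ v) :+ (t :* u :+ v′) :=
                   (t :* a :* w :+ t :* (n :+ u)) :+ (v :+ v′)) ≈.refl t₀ a₀ w (- u) v u v′ ⟩
    (t₀ * a₀ * w + t₀ * (- u + u)) + (v + v′)
      ≈⟨ +-cong (≈.trans (+-congˡ (≈.trans (*-congˡ (-‿inverseˡ u)) (zeroʳ t₀))) (+-identityʳ _))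
                (contract-wedge t′ a′ (ω ∘ (outside ∷_)) S) ⟩
    t₀ * a₀ * w + t′ · a′ * w
      ≈⟨ distribʳ w _ _ ⟨
    t · a * w ∎
    where
    t₀ = t zero
    a₀ = a zero
    t′ = t ∘ suc
    a′ = a ∘ suc
    w = ω (outside ∷ S)
    u = wedge a′ (ω ∘ (inside ∷_)) S
    v = contract t′ (wedge a′ (ω ∘ (outside ∷_))) S
    v′ = wedge a′ (contract t′ (ω ∘ (outside ∷_))) S
  contract-wedge t a ω (inside ∷ S) = begin
    - contract t′ (λ T → a₀ * ω (outside ∷ T) - wedge a′ (ω ∘ (inside ∷_)) T) S
      + (a₀ * (t₀ * w + y) - wedge a′ (λ T → - contract t′ (ω ∘ (inside ∷_)) T) S)
      ≈⟨ +-cong (-‿cong (contract-linear t′ a₀ (ω ∘ (outside ∷_)) (wedge a′ (ω ∘ (inside ∷_))) S))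
                (+-congˡ (≈.trans (-‿cong (wedge-neg a′ (contract t′ (ω ∘ (inside ∷_))) S))
                                (-‿involutive z))) ⟩
    - (a₀ * y - v) + (a₀ * (t₀ * w + y) + z)
      ≈⟨ +-congʳ (≈.trans (≈.sym (-‿+-comm _ _)) (+-cong (-‿distribʳ-* a₀ y) (-‿involutive v))) ⟩
    (a₀ * (- y) + v) + (a₀ * (t₀ * w + y) + z)
      ≈⟨ solve 7 (λ t a w n v y z → (a :* n :+ v) :+ (a :* (t :* w :+ y) :+ z) :=
                   (t :* a :* w :+ a :* (n :+ y)) :+ (v :+ z)) ≈.refl t₀ a₀ w (- y) v y z ⟩
    (t₀ * a₀ * w + a₀ * (- y + y)) + (v + z)
      ≈⟨ +-cong (≈.trans (+-congˡ (≈.trans (*-congˡ (-‿inverseˡ y)) (zeroʳ a₀))) (+-identityʳ _))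
                (contract-wedge t′ a′ (ω ∘ (inside ∷_)) S) ⟩
    t₀ * a₀ * w + t′ · a′ * w
      ≈⟨ distribʳ w _ _ ⟨
    t · a * w ∎
    where
    t₀ = t zero
    a₀ = a zero
    t′ = t ∘ suc
    a′ = a ∘ suc
    w = ω (inside ∷ S)
    y = contract t′ (ω ∘ (outside ∷_)) S
    v = contract t′ (wedge a′ (ω ∘ (inside ∷_))) S
    z = wedge a′ (contract t′ (ω ∘ (inside ∷_))) S

  unit : ∀ {n} → Form n
  unit []            = 1#
  unit (outside ∷ S) = unit S
  unit (inside ∷ S)  = 0#

  rowWedge : ∀ {d n} → (Fin d → Vector n) → Form n
  rowWedge {zero}  A = unit
  rowWedge {suc d} A = wedge (A zero) (rowWedge (A ∘ suc))

  contract-zeroForm : ∀ {n} t {ω : Form n} → (∀ S → ω S ≈ 0#) → ∀ S → contract t ω S ≈ 0#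
  contract-zeroForm t ω≈0 []            = ≈.refl
  contract-zeroForm t ω≈0 (outside ∷ S) =
    ≈.trans (+-cong (≈.trans (*-congˡ (ω≈0 (inside ∷ S))) (zeroʳ _))
                  (contract-zeroForm _ (ω≈0 ∘ (outside ∷_)) S))
          (+-identityʳ 0#)
  contract-zeroForm t ω≈0 (inside ∷ S)  =
    ≈.trans (-‿cong (contract-zeroForm _ (ω≈0 ∘ (inside ∷_)) S)) -0#≈0#

  contract-unit : ∀ {n} t (S : Subset n) → contract t unit S ≈ 0#
  contract-unit t []            = ≈.refl
  contract-unit t (outside ∷ S) =
    ≈.trans (+-cong (zeroʳ _) (contract-unit _ S)) (+-identityʳ 0#)
  contract-unit t (inside ∷ S)  =
    ≈.trans (-‿cong (contract-zeroForm _ (λ _ → ≈.refl) S)) -0#≈0#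

  Relation : ∀ {d n} → (Fin d → Vector n) → Vector n → Set ℓ
  Relation A t = ∀ i → t · A i ≈ 0#

  -- Every row pairs to zero with `t`, so the antiderivation rule moves the contraction past the
  -- rows one at a time until it meets `unit`, which it kills.
  contract-rowWedge : ∀ {d n} (A : Fin d → Vector n) {t} → Relation A t →
                      ∀ S → contract t (rowWedge A) S ≈ 0#
  contract-rowWedge {zero}  A {t} t⊥A S = contract-unit t S
  contract-rowWedge {suc d} A {t} t⊥A S = begin
    contract t (wedge a ω) S                          ≈⟨ +-identityʳ _ ⟨
    contract t (wedge a ω) S + 0#
      ≈⟨ +-congˡ (wedge-zero a (contract-rowWedge (A ∘ suc) (t⊥A ∘ suc)) S) ⟨
    contract t (wedge a ω) S + wedge a (contract t ω) S ≈⟨ contract-wedge t a ω S ⟩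
    t · a * ω S                                       ≈⟨ *-congʳ (t⊥A zero) ⟩
    0# * ω S                                          ≈⟨ zeroˡ _ ⟩
    0#                                                ∎
    where
    a = A zero
    ω = rowWedge (A ∘ suc)

  -- Linear relations among minors

  private
    add-zero : ∀ {x y} → x ≈ 0# → y ≈ 0# → x + y ≈ 0#
    add-zero x≈0 y≈0 = ≈.trans (+-cong x≈0 y≈0) (+-identityʳ 0#)

  signed : Sign → Carrier → Carrier
  signed Sign.+ x = x
  signed Sign.- x = - x

  signed-cong : ∀ s {x y} → x ≈ y → signed s x ≈ signed s y
  signed-cong Sign.+ x≈y = x≈y
  signed-cong Sign.- x≈y = -‿cong x≈y

  signed-opposite : ∀ s x → - signed s x ≈ signed (Sign.opposite s) x
  signed-opposite Sign.+ x = ≈.refl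
  signed-opposite Sign.- x = -‿involutive x

  signed-* : ∀ s t x → signed s (signed t x) ≈ signed (s Sign.* t) x
  signed-* Sign.+ t x = ≈.refl
  signed-* Sign.- t x = signed-opposite t x

  signed-*ˡ : ∀ s x y → signed s x * y ≈ signed s (x * y)
  signed-*ˡ Sign.+ x y = ≈.refl
  signed-*ˡ Sign.- x y = ≈.sym (-‿distribˡ-* x y)

  signed-+ : ∀ s x y → signed s (x + y) ≈ signed s x + signed s y
  signed-+ Sign.+ x y = ≈.refl
  signed-+ Sign.- x y = ≈.sym (-‿+-comm x y)

  signed-zero : ∀ s {x} → x ≈ 0# → signed s x ≈ 0#
  signed-zero Sign.+ x≈0 = x≈0
  signed-zero Sign.- x≈0 = ≈.trans (-‿cong x≈0) -0#≈0#

  signed-zero⁻¹ : ∀ s {x} → signed s x ≈ 0# → x ≈ 0#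
  signed-zero⁻¹ Sign.+ x≈0 = x≈0
  signed-zero⁻¹ Sign.- x≈0 = -‿injective (≈.trans x≈0 (≈.sym -0#≈0#))

  -- Peels off the term at `e`. The remainder is again a contraction, with the entry of `t` at `e`
  -- set to zero, so the peeling can be repeated.
  contract-split : ∀ {n} t (ω : Form n) Q e → lookup Q e ≡ outside →
    contract t ω Q ≈
      signed (position-sign Q e) (t e * ω (Q [ e ]≔ inside)) + contract (updateAt t e (const 0#)) ω Q
  contract-split t ω (outside ∷ Q) zero e∉Q = +-congˡ (begin
    r                                  ≈⟨ +-identityˡ r ⟨
    0# + r                             ≈⟨ +-congʳ (zeroˡ _) ⟨
    0# * ω (inside ∷ Q) + r            ∎)
    where r = contract (t ∘ suc) (ω ∘ (outside ∷_)) Q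
  contract-split t ω (outside ∷ Q) (suc e) e∉Q =
    ≈.trans (+-congˡ (contract-split (t ∘ suc) (ω ∘ (outside ∷_)) Q e e∉Q))
          (solve 3 (λ x y z → x :+ (y :+ z) := y :+ (x :+ z)) ≈.refl _ _ _)
  contract-split t ω (inside ∷ Q)  (suc e) e∉Q =
    ≈.trans (-‿cong (contract-split (t ∘ suc) (ω ∘ (inside ∷_)) Q e e∉Q))
          (≈.trans (≈.sym (-‿+-comm _ _)) (+-congʳ (signed-opposite (position-sign Q e) _)))

  contract-vanish : ∀ {n} t (ω : Form n) Q →
    (∀ j → lookup Q j ≡ outside → t j * ω (Q [ j ]≔ inside) ≈ 0#) → contract t ω Q ≈ 0#
  contract-vanish t ω []            h = ≈.refl
  contract-vanish t ω (outside ∷ Q) h =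
    add-zero (h zero refl) (contract-vanish _ (ω ∘ (outside ∷_)) Q (h ∘ suc))
  contract-vanish t ω (inside ∷ Q)  h =
    ≈.trans (-‿cong (contract-vanish _ (ω ∘ (inside ∷_)) Q (h ∘ suc))) -0#≈0#

  private
    updateAt-≈0 : ∀ {n} (t : Vector n) e j {x} → (j ≢ e → t j * x ≈ 0#) →
                  updateAt t e (const 0#) j * x ≈ 0#
    updateAt-≈0 t e j {x} h with j Fin.≟ e
    ... | yes refl = ≈.trans (*-congʳ (reflexive (updateAt-updates j t))) (zeroˡ x)
    ... | no  j≢e    = ≈.trans (*-congʳ (reflexive (updateAt-minimal j e t j≢e))) (h j≢e)

  module _ {d n} (A : Fin d → Vector n) {t} (t⊥A : Relation A t) (Q : Subset n) where
    private p = rowWedge A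

    -- The contraction vanishes at `Q`, and there it is a signed sum of the terms `t j` times the
    -- minor of `Q` with `j` added; a term left alone in it must vanish too.
    one-term-relation : ∀ e → lookup Q e ≡ outside →
      (∀ j → lookup Q j ≡ outside → j ≢ e → t j * p (Q [ j ]≔ inside) ≈ 0#) →
      t e * p (Q [ e ]≔ inside) ≈ 0#
    one-term-relation e e∉Q h = signed-zero⁻¹ (position-sign Q e) (begin
      signed (position-sign Q e) (t e * p (Q [ e ]≔ inside))  ≈⟨ +-identityʳ _ ⟨
      signed (position-sign Q e) (t e * p (Q [ e ]≔ inside)) + 0#
        ≈⟨ +-congˡ (contract-vanish _ p Q (λ j j∉Q → updateAt-≈0 t e j (h j j∉Q))) ⟨
      signed (position-sign Q e) (t e * p (Q [ e ]≔ inside)) + contract (updateAt t e (const 0#)) p Q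
        ≈⟨ contract-split t p Q e e∉Q ⟨
      contract t p Q ≈⟨ contract-rowWedge A t⊥A Q ⟩
      0# ∎)

    two-term-relation : ∀ e f → lookup Q e ≡ outside → lookup Q f ≡ outside → f ≢ e →
      (∀ j → lookup Q j ≡ outside → j ≢ e → j ≢ f → t j * p (Q [ j ]≔ inside) ≈ 0#) →
      signed (position-sign Q e) (t e * p (Q [ e ]≔ inside))
        + signed (position-sign Q f) (t f * p (Q [ f ]≔ inside)) ≈ 0#
    two-term-relation e f e∉Q f∉Q f≢e h = begin
      E + signed s (t f * p (Q [ f ]≔ inside))
        ≈⟨ +-congˡ (signed-cong s (*-congʳ (reflexive (updateAt-minimal f e t f≢e)))) ⟨
      E + signed s (t₁ f * p (Q [ f ]≔ inside))
        ≈⟨ +-congˡ (+-identityʳ _) ⟨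
      E + (signed s (t₁ f * p (Q [ f ]≔ inside)) + 0#)
        ≈⟨ +-congˡ (+-congˡ (contract-vanish _ p Q (λ j j∉Q → updateAt-≈0 t₁ f j λ j≢f →
             updateAt-≈0 t e j λ j≢e → h j j∉Q j≢e j≢f))) ⟨
      E + (signed s (t₁ f * p (Q [ f ]≔ inside)) + contract (updateAt t₁ f (const 0#)) p Q)
        ≈⟨ +-congˡ (contract-split t₁ p Q f f∉Q) ⟨
      E + contract t₁ p Q
        ≈⟨ contract-split t p Q e e∉Q ⟨
      contract t p Q ≈⟨ contract-rowWedge A t⊥A Q ⟩
      0# ∎
      where
      E = signed (position-sign Q e) (t e * p (Q [ e ]≔ inside))
      s = position-sign Q f
      t₁ = updateAt t e (const 0#)

  -- Passing a generator outside `S` leaves the index `j` alone; passing one in `S` raises the later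
  -- indices by one, which accounts for one factor `- 1#`.
  laplace : ∀ {n} a (ω : Form n) S →
    wedge a ω S ≈ sum (λ j → ((- 1#) ^ toℕ j) * (a (lookup (elements S) j) * ω (removeAt S j)))
  laplace a ω []            = ≈.refl
  laplace a ω (outside ∷ S) =
    ≈.trans (laplace (a ∘ suc) (ω ∘ (outside ∷_)) S)
          (sum-cong-≋ λ j → *-congˡ (*-congʳ (reflexive (cong a (sym (lookup-map j suc (elements S)))))))
  laplace a ω (inside ∷ S)  = +-cong (≈.sym (*-identityˡ _)) (begin
    - wedge (a ∘ suc) (ω ∘ (inside ∷_)) S   ≈⟨ -1*x≈-x _ ⟨
    - 1# * wedge (a ∘ suc) (ω ∘ (inside ∷_)) S
      ≈⟨ *-congˡ (laplace (a ∘ suc) (ω ∘ (inside ∷_)) S) ⟩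
    - 1# * sum (λ j → ((- 1#) ^ toℕ j) * term j)
      ≈⟨ *-distribˡ-sum (- 1#) (λ j → ((- 1#) ^ toℕ j) * term j) ⟩
    sum (λ j → - 1# * (((- 1#) ^ toℕ j) * term j))
      ≈⟨ sum-cong-≋ (λ j → ≈.trans (≈.sym (*-assoc _ _ _))
           (*-congˡ (*-congʳ (reflexive (cong a (sym (lookup-map j suc (elements S)))))))) ⟩
    sum (λ j → ((- 1#) ^ toℕ (suc j)) *
               (a (lookup (Vec.map suc (elements S)) j) * ω (inside ∷ removeAt S j))) ∎)
    where term = λ j → a (suc (lookup (elements S) j)) * ω (inside ∷ removeAt S j)

module Minors {c ℓ} (ℝ : Reals c ℓ) where
  open Reals ℝ hiding (zero; refl; sym; trans)
  private module ≈ = Reals ℝ using (refl; sym; trans)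
  open Forms commutativeRing
  open import Algebra.Properties.Monoid.Sum +-monoid using (sum-cong-≋)
  open import Relation.Binary.Reasoning.Setoid setoid

  det-cong : ∀ {d} {A B : Matrix ℝ d d} → (∀ i j → A i j ≡ B i j) → det ℝ A ≈ det ℝ B
  det-cong {zero}  A≡B = ≈.refl
  det-cong {suc d} A≡B = sum-cong-≋ λ j → *-congˡ {(- 1#) ^ toℕ j}
    (*-cong (reflexive (A≡B zero j)) (det-cong λ i k → A≡B (suc i) (punchIn j k)))

  sum-cast : ∀ {m n} (e : m ≡ n) (f : Fin n → Carrier) → sum f ≈ sum (f ∘ Fin.cast e)
  sum-cast refl f = sum-cong-≋ λ j → reflexive (cong f (sym (Fin.cast-is-id refl j)))

  -- Induction on the rows: by `laplace` the wedge satisfies the expansion along the first row that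
  -- defines `det`.
  maximalMinor≈rowWedge : ∀ {d n} (A : Matrix ℝ d n) S (e : d ≡ ∣ S ∣) →
                          maximalMinor ℝ A S e ≈ rowWedge A S
  maximalMinor≈rowWedge {zero} A S e = ≈.sym (unit-empty S e)
    where
    unit-empty : ∀ {n} (S : Subset n) → 0 ≡ ∣ S ∣ → unit S ≈ 1#
    unit-empty []            _ = ≈.refl
    unit-empty (outside ∷ S) e = unit-empty S e
  maximalMinor≈rowWedge {suc d} A S e = begin
    maximalMinor ℝ A S e
      ≈⟨ sum-cong-≋ {suc d} (λ j → *-cong (reflexive (cong ((- 1#) ^_) (sym (Fin.toℕ-cast e j))))
           (*-congˡ {A zero (lookup (elements S) (Fin.cast e j))} (≈.trans (det-cong λ i k →
              cong (A (suc i)) (sym (elements-removeAt S e j (size-removeAt′ j) k)))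
             (maximalMinor≈rowWedge (A ∘ suc) (removeAt S (Fin.cast e j)) (size-removeAt′ j))))) ⟩
    sum (term ∘ Fin.cast e)     ≈⟨ sum-cast e term ⟨
    sum term                    ≈⟨ laplace (A zero) (rowWedge (A ∘ suc)) S ⟨
    rowWedge A S                ∎
    where
    term = λ j → ((- 1#) ^ toℕ j) * (A zero (lookup (elements S) j) * rowWedge (A ∘ suc) (removeAt S j))
    size-removeAt′ : ∀ j → d ≡ ∣ removeAt S (Fin.cast e j) ∣
    size-removeAt′ j = ℕₚ.suc-injective (trans e (sym (size-removeAt S (Fin.cast e j))))

-- Closure and linear relations

infixl 7 _⊕_ _⊖_

_⊕_ _⊖_ : ∀ {n} → Subset n → Fin n → Subset n
S ⊕ j = S [ j ]≔ inside
S ⊖ j = S [ j ]≔ outside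

infix 4 _∋_ _∌_

-- Membership as an equation between Booleans, so that both membership and its failure are positive
-- statements that follow updates of the subset.
_∋_ _∌_ : ∀ {n} → Subset n → Fin n → Set
S ∋ j = lookup S j ≡ inside
S ∌ j = lookup S j ≡ outside

∋⇒¬∌ : ∀ {n} (S : Subset n) {j} → S ∋ j → ¬ S ∌ j
∋⇒¬∌ S S∋j S∌j = contradiction (trans (sym S∋j) S∌j) λ ()

∋∌⇒≢ : ∀ {n} (S : Subset n) {i j} → S ∋ i → S ∌ j → i ≢ j
∋∌⇒≢ S S∋i S∌j refl = ∋⇒¬∌ S S∋i S∌j

update-self : ∀ {n} (S : Subset n) j {s} → lookup S j ≡ s → S [ j ]≔ s ≡ S
update-self S j refl = []≔-lookup S j

⊖-⊕ : ∀ {n} (S : Subset n) {j} → S ∋ j → S ⊖ j ⊕ j ≡ S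
⊖-⊕ S {j} S∋j = trans ([]≔-idempotent S j) (update-self S j S∋j)

∣⊕∣ : ∀ {n} (S : Subset n) {j} → S ∌ j → ∣ S ⊕ j ∣ ≡ suc ∣ S ∣
∣⊕∣ (outside ∷ S) {zero}  S∌j = refl
∣⊕∣ (outside ∷ S) {suc j} S∌j = ∣⊕∣ S S∌j
∣⊕∣ (inside ∷ S)  {suc j} S∌j = cong suc (∣⊕∣ S S∌j)

-- Requiring `j` outside `S ⊖ i` rather than outside `S` admits the trivial exchange with `j` equal
-- to `i`.
∣swap∣ : ∀ {n} (S : Subset n) {i j} → S ∋ i → S ⊖ i ∌ j → ∣ S ⊖ i ⊕ j ∣ ≡ ∣ S ∣
∣swap∣ S {i} {j} S∋i Q∌j = begin
  ∣ S ⊖ i ⊕ j ∣  ≡⟨ ∣⊕∣ (S ⊖ i) Q∌j ⟩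
  suc ∣ S ⊖ i ∣  ≡⟨ ∣⊕∣ (S ⊖ i) (lookup∘update i S outside) ⟨
  ∣ S ⊖ i ⊕ i ∣  ≡⟨ cong ∣_∣ (⊖-⊕ S S∋i) ⟩
  ∣ S ∣          ∎
  where open ≡-Reasoning

∩-updateˡ : ∀ {n} (S C : Subset n) j s → (S [ j ]≔ s) ∩ C ≡ (S ∩ C) [ j ]≔ (s ∧ lookup C j)
∩-updateˡ (_ ∷ S) (_ ∷ C) zero    s = refl
∩-updateˡ (_ ∷ S) (_ ∷ C) (suc j) s = cong (_ ∷_) (∩-updateˡ S C j s)

∩-updateʳ : ∀ {n} (S C : Subset n) j s → S ∩ (C [ j ]≔ s) ≡ (S ∩ C) [ j ]≔ (lookup S j ∧ s)
∩-updateʳ (_ ∷ S) (_ ∷ C) zero    s = refl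
∩-updateʳ (_ ∷ S) (_ ∷ C) (suc j) s = cong (_ ∷_) (∩-updateʳ S C j s)

∩-∌ˡ : ∀ {n} (S C : Subset n) {j} → S ∌ j → S ∩ C ∌ j
∩-∌ˡ S C {j} S∌j = trans (lookup-zipWith _∧_ j S C) (cong (_∧ lookup C j) S∌j)

∩-∌ʳ : ∀ {n} (S C : Subset n) {j} → C ∌ j → S ∩ C ∌ j
∩-∌ʳ S C {j} C∌j =
  trans (lookup-zipWith _∧_ j S C) (trans (cong (lookup S j ∧_) C∌j) (Bool.∧-zeroʳ (lookup S j)))

⊕-∌ : ∀ {n} (S : Subset n) {i j} → S ∌ j → j ≢ i → S ⊕ i ∌ j
⊕-∌ S S∌j j≢i = trans (lookup∘update′ j≢i S inside) S∌j

⊖-∌ : ∀ {n} (S : Subset n) {i j} → S ∌ j → S ⊖ i ∌ j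
⊖-∌ S {i} {j} S∌j with j Fin.≟ i
... | yes refl = lookup∘update i S outside
... | no j≢i   = trans (lookup∘update′ j≢i S outside) S∌j

∌-⊖ : ∀ {n} (S : Subset n) {i j} → S ⊖ i ∌ j → j ≢ i → S ∌ j
∌-⊖ S Q∌j j≢i = trans (sym (lookup∘update′ j≢i S outside)) Q∌j

∌-⊕ : ∀ {n} (S : Subset n) {i j} → S ⊕ i ∌ j → S ∌ j
∌-⊕ S {i} {j} S⊕i∌j with j Fin.≟ i
... | yes refl = contradiction S⊕i∌j (∋⇒¬∌ (S ⊕ i) (lookup∘update i S inside))
... | no j≢i   = trans (sym (lookup∘update′ j≢i S inside)) S⊕i∌j

∌-⊕-≢ : ∀ {n} (S : Subset n) {i j} → S ⊕ i ∌ j → j ≢ i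
∌-⊕-≢ S {i} S⊕i∌j refl = ∋⇒¬∌ (S ⊕ i) (lookup∘update i S inside) S⊕i∌j

∣∩⊕∣-∋ : ∀ {n} (B C : Subset n) {e} → B ∋ e → C ∌ e → ∣ B ∩ (C ⊕ e) ∣ ≡ suc ∣ B ∩ C ∣
∣∩⊕∣-∋ B C {e} B∋e C∌e = trans
  (cong ∣_∣ (trans (∩-updateʳ B C e inside) (cong (λ s → (B ∩ C) [ e ]≔ (s ∧ inside)) B∋e)))
  (∣⊕∣ (B ∩ C) (∩-∌ʳ B C C∌e))

∩⊕-∌ : ∀ {n} (B C : Subset n) {e} → B ∌ e → B ∩ (C ⊕ e) ≡ B ∩ C
∩⊕-∌ B C {e} B∌e =
  trans (∩-updateʳ B C e inside)
        (trans (cong (λ s → (B ∩ C) [ e ]≔ (s ∧ inside)) B∌e) (update-self (B ∩ C) e (∩-∌ˡ B C B∌e)))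

∣∩⊕∣≤ : ∀ {n} (B C : Subset n) e → ∣ B ∩ (C ⊕ e) ∣ ℕ.≤ suc ∣ B ∩ C ∣
∣∩⊕∣≤ B C e with lookup B e in eq | lookup C e in eq′
... | outside | _       = ℕₚ.≤-trans (ℕₚ.≤-reflexive (cong ∣_∣ (∩⊕-∌ B C eq))) (ℕₚ.n≤1+n _)
... | inside  | inside  =
  ℕₚ.≤-trans (ℕₚ.≤-reflexive (cong (λ D → ∣ B ∩ D ∣) (update-self C e eq′))) (ℕₚ.n≤1+n _)
... | inside  | outside = ℕₚ.≤-reflexive (∣∩⊕∣-∋ B C eq eq′)

∣∩⊕∣≥ : ∀ {n} (B C : Subset n) e → ∣ B ∩ C ∣ ℕ.≤ ∣ B ∩ (C ⊕ e) ∣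
∣∩⊕∣≥ B C e with lookup B e in eq | lookup C e in eq′
... | outside | _       = ℕₚ.≤-reflexive (sym (cong ∣_∣ (∩⊕-∌ B C eq)))
... | inside  | inside  = ℕₚ.≤-reflexive (sym (cong (λ D → ∣ B ∩ D ∣) (update-self C e eq′)))
... | inside  | outside = ℕₚ.≤-trans (ℕₚ.n≤1+n _) (ℕₚ.≤-reflexive (sym (∣∩⊕∣-∋ B C eq eq′)))

⊕-comm : ∀ {n} (C : Subset n) i j → C ⊕ i ⊕ j ≡ C ⊕ j ⊕ i
⊕-comm C i j with i Fin.≟ j
... | yes refl = refl
... | no i≢j   = []≔-commutes C i j i≢j

-- Rank and closure in a matroid

module Rank {n} (M : Matroid n) where
  open Matroid M

  private
    candidates : Subset n → List ℕ
    candidates S = List.map (λ B → ∣ B ∩ S ∣) (List.filter basis? (allSubsets n))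

    allSubsets-complete : ∀ {m} (S : Subset m) → S List.∈ allSubsets m
    allSubsets-complete []            = here refl
    allSubsets-complete (inside ∷ S)  = ∈-++⁺ˡ (∈-map⁺ (inside ∷_) (allSubsets-complete S))
    allSubsets-complete (outside ∷ S) =
      ∈-++⁺ʳ (List.map (inside ∷_) (allSubsets _)) (∈-map⁺ (outside ∷_) (allSubsets-complete S))

  ∣B∩S∣≤rk : ∀ {B} → Basis B → ∀ S → ∣ B ∩ S ∣ ℕ.≤ rk M S
  ∣B∩S∣≤rk {B} basis S = All.lookup (xs≤max 0 (candidates S))
    (∈-map⁺ (λ B → ∣ B ∩ S ∣) (∈-filter⁺ basis? (allSubsets-complete B) basis))

  rk-attained : ∀ S → ∃[ B ] Basis B × ∣ B ∩ S ∣ ≡ rk M S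
  rk-attained S with argmax-sel id 0 (candidates S)
  ... | inj₂ rk∈ with B , B∈ , rk≡ ← ∈-map⁻ (λ B → ∣ B ∩ S ∣) rk∈ =
    B , proj₂ (∈-filter⁻ basis? {xs = allSubsets n} B∈) , sym rk≡
  -- The maximum may be its default value 0; then any basis attains it.
  ... | inj₁ rk≡0 with B , basis ← nonempty =
    B , basis , ℕₚ.≤-antisym (∣B∩S∣≤rk basis S) (subst (ℕ._≤ ∣ B ∩ S ∣) (sym rk≡0) ℕ.z≤n)

  >rk⇒¬Basis : ∀ {B} S → rk M S ℕ.< ∣ B ∩ S ∣ → ¬ Basis B
  >rk⇒¬Basis S rk< basis = ℕₚ.<⇒≱ rk< (∣B∩S∣≤rk basis S)

  rk-⊕-≥ : ∀ C e → rk M C ℕ.≤ rk M (C ⊕ e)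
  rk-⊕-≥ C e with B , basis , eq ← rk-attained C =
    subst (ℕ._≤ _) eq (ℕₚ.≤-trans (∣∩⊕∣≥ B C e) (∣B∩S∣≤rk basis (C ⊕ e)))

  rk-⊕-≤ : ∀ C e → rk M (C ⊕ e) ℕ.≤ suc (rk M C)
  rk-⊕-≤ C e with B , basis , eq ← rk-attained (C ⊕ e) =
    subst (ℕ._≤ _) eq (ℕₚ.≤-trans (∣∩⊕∣≤ B C e) (ℕ.s≤s (∣B∩S∣≤rk basis C)))

  infix 4 _⊢_ _⊢?_
  _⊢_ : Subset n → Fin n → Set
  C ⊢ e = rk M (C ⊕ e) ≡ rk M C

  _⊢?_ : ∀ C e → Dec (C ⊢ e)
  C ⊢? e = rk M (C ⊕ e) ℕₚ.≟ rk M C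

  ⊬⇒rk< : ∀ {C e} → ¬ C ⊢ e → rk M C ℕ.< rk M (C ⊕ e)
  ⊬⇒rk< C⊬e = ℕₚ.≤∧≢⇒< (rk-⊕-≥ _ _) (C⊬e ∘′ sym)

  ∋⇒⊢ : ∀ C {e} → C ∋ e → C ⊢ e
  ∋⇒⊢ C {e} C∋e = cong (rk M) (update-self C e C∋e)

  -- Adding `b` and then `e` never raises the rank of `C`, and `C ⊕ e` lies in between.
  ⊢-trans : ∀ {C e b} → C ⊢ b → C ⊕ b ⊢ e → C ⊢ e
  ⊢-trans {C} {e} {b} C⊢b C⊕b⊢e = ℕₚ.≤-antisym (begin
    rk M (C ⊕ e)     ≤⟨ rk-⊕-≥ (C ⊕ e) b ⟩
    rk M (C ⊕ e ⊕ b) ≡⟨ cong (rk M) (⊕-comm C e b) ⟩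
    rk M (C ⊕ b ⊕ e) ≡⟨ C⊕b⊢e ⟩
    rk M (C ⊕ b)     ≡⟨ C⊢b ⟩
    rk M C           ∎) (rk-⊕-≥ C e)
    where open ≤-Reasoning

  -- The exchange property of closure: `C ⊕ b` has rank at most one above `C`, and `C ⊕ e` already
  -- reaches that rank.
  ⊢-exchange : ∀ {C e b} → C ⊕ b ⊢ e → ¬ C ⊢ e → C ⊕ e ⊢ b
  ⊢-exchange {C} {e} {b} C⊕b⊢e C⊬e = ℕₚ.≤-antisym (begin
    rk M (C ⊕ e ⊕ b) ≡⟨ cong (rk M) (⊕-comm C e b) ⟩
    rk M (C ⊕ b ⊕ e) ≡⟨ C⊕b⊢e ⟩
    rk M (C ⊕ b)     ≤⟨ rk-⊕-≤ C b ⟩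
    suc (rk M C)     ≤⟨ ⊬⇒rk< C⊬e ⟩
    rk M (C ⊕ e)     ∎) (rk-⊕-≥ (C ⊕ e) b)
    where open ≤-Reasoning

module Field {c ℓ} (ℝ : Reals c ℓ) where
  open Reals ℝ hiding (zero; refl; sym; trans)
  module ≈ = Reals ℝ using (refl; sym; trans)
  open import Relation.Binary.Reasoning.Setoid setoid

  -- The order is trichotomous, so equality is decidable and equations may be proved by
  -- contradiction.
  ≈-stable : ∀ {x y} → ¬ ¬ x ≈ y → x ≈ y
  ≈-stable = decidable-stable (IsStrictTotalOrder._≟_ isStrictTotalOrder _ _)

  cancel-nonzeroˡ : ∀ {x y} → ¬ x ≈ 0# → x * y ≈ 0# → y ≈ 0#
  cancel-nonzeroˡ {x} {y} x≉0 xy≈0 with x⁻¹ , xx⁻¹≈1 ← inverse x x≉0 = begin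
    y               ≈⟨ *-identityˡ y ⟨
    1# * y          ≈⟨ *-congʳ (≈.trans (*-comm x⁻¹ x) xx⁻¹≈1) ⟨
    (x⁻¹ * x) * y   ≈⟨ *-assoc x⁻¹ x y ⟩
    x⁻¹ * (x * y)   ≈⟨ *-congˡ xy≈0 ⟩
    x⁻¹ * 0#        ≈⟨ zeroʳ x⁻¹ ⟩
    0#              ∎

  cancel-nonzeroʳ : ∀ {x y} → ¬ y ≈ 0# → x * y ≈ 0# → x ≈ 0#
  cancel-nonzeroʳ y≉0 xy≈0 = cancel-nonzeroˡ y≉0 (≈.trans (*-comm _ _) xy≈0)

-- Closure as linear dependence of columns

module Representation {c ℓ} (ℝ : Reals c ℓ) {n} (M : Matroid n) {d} (A : Matrix ℝ d n)
                      (hasRank : HasRank ℝ A d) (columnMatroid : IsColumnMatroid ℝ A M) where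
  open Reals ℝ hiding (zero; refl; sym; trans; _-_)
  open Field ℝ
  open Forms commutativeRing
  open Minors ℝ
  open Matroid M
  open Rank M

  p : Form n
  p = rowWedge A

  basis-size : ∀ {B} → Basis B → d ≡ ∣ B ∣
  basis-size {B} basis = proj₁ (Equivalence.to (columnMatroid B) basis)

  basis⇒p≉0 : ∀ {B} → Basis B → ¬ p B ≈ 0#
  basis⇒p≉0 {B} basis pB≈0 with e , minor≉0 ← Equivalence.to (columnMatroid B) basis =
    minor≉0 (≈.trans (maximalMinor≈rowWedge A B e) pB≈0)

  p≉0⇒basis : ∀ {B} → d ≡ ∣ B ∣ → ¬ p B ≈ 0# → Basis B
  p≉0⇒basis {B} e pB≉0 = Equivalence.from (columnMatroid B)
    (e , λ minor≈0 → pB≉0 (≈.trans (≈.sym (maximalMinor≈rowWedge A B e)) minor≈0))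

  swap-nonbasis : ∀ {B b j} → Basis B → B ∋ b → B ⊖ b ∌ j → ¬ Basis (B ⊖ b ⊕ j) → p (B ⊖ b ⊕ j) ≈ 0#
  swap-nonbasis {B} basis B∋b Q∌j nonbasis = ≈-stable λ p≉0 →
    nonbasis (p≉0⇒basis (trans (basis-size basis) (sym (∣swap∣ B B∋b Q∌j))) p≉0)

  -- The one-term relation at `B ⊖ b`: the term of `b` is `t b` times the nonzero minor of `B`, and
  -- the hypothesis kills all other terms.
  relation-at : ∀ {B b t} → Relation A t → Basis B → B ∋ b →
    (∀ j → B ⊖ b ∌ j → j ≢ b → t j ≈ 0# ⊎ p (B ⊖ b ⊕ j) ≈ 0#) → t b ≈ 0#
  relation-at {B} {b} {t} t⊥A basis B∋b h = cancel-nonzeroʳ (basis⇒p≉0 basis)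
    (≈.trans (*-congˡ (reflexive (cong p (sym (⊖-⊕ B B∋b)))))
      (one-term-relation A t⊥A (B ⊖ b) b (lookup∘update b B outside) vanish))
    where
    vanish : ∀ j → B ⊖ b ∌ j → j ≢ b → t j * p (B ⊖ b ⊕ j) ≈ 0#
    vanish j Q∌j j≢b with h j Q∌j j≢b
    ... | inj₁ t≈0 = ≈.trans (*-congʳ t≈0) (zeroˡ _)
    ... | inj₂ p≈0 = ≈.trans (*-congˡ p≈0) (zeroʳ _)

  Spans : Subset n → Fin n → Set _
  Spans C e = ∃[ t ] Relation A t × ¬ t e ≈ 0# × (∀ j → C ∌ j → j ≢ e → t j ≈ 0#)

  -- If `e` were not in the closure, a basis meeting `C ⊕ e` in as many elements as possible would
  -- contain `e`. Exchanging `e` for an element of `C` would then meet `C` in more than `rk M C`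
  -- elements, so no such exchange is a basis and `relation-at` makes `t e` zero.
  spans⇒⊢ : ∀ {C e} → C ∌ e → Spans C e → C ⊢ e
  spans⇒⊢ {C} {e} C∌e (t , t⊥A , te≉0 , supp) with C ⊢? e
  ... | yes C⊢e = C⊢e
  ... | no  C⊬e with B , basis , ∣B∩∣≡rk ← rk-attained (C ⊕ e) with lookup B e in eq
  ...   | outside = contradiction (∣B∩S∣≤rk basis C) (ℕₚ.<⇒≱
            (subst (rk M C ℕ.<_) (trans (sym ∣B∩∣≡rk) (cong ∣_∣ (∩⊕-∌ B C eq))) (⊬⇒rk< C⊬e)))
  ...   | inside  = contradiction (relation-at t⊥A basis eq λ j Q∌j j≢e → vanish j Q∌j j≢e) te≉0
    where
    B∩C≡Q∩C : (B ⊖ e) ∩ C ≡ B ∩ C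
    B∩C≡Q∩C = trans (∩-updateˡ B C e outside) (update-self (B ∩ C) e (∩-∌ʳ B C C∌e))

    vanish : ∀ j → B ⊖ e ∌ j → j ≢ e → t j ≈ 0# ⊎ p (B ⊖ e ⊕ j) ≈ 0#
    vanish j Q∌j j≢e with lookup C j in C?j
    ... | outside = inj₁ (supp j C?j j≢e)
    ... | inside  = inj₂ (swap-nonbasis basis eq Q∌j (>rk⇒¬Basis C (begin-strict
      rk M C                  <⟨ ⊬⇒rk< C⊬e ⟩
      rk M (C ⊕ e)            ≡⟨ ∣B∩∣≡rk ⟨
      ∣ B ∩ (C ⊕ e) ∣         ≡⟨ ∣∩⊕∣-∋ B C eq C∌e ⟩
      suc ∣ B ∩ C ∣           ≡⟨ ∣⊕∣ (B ∩ C) (∩-∌ˡ B C (∌-⊖ B Q∌j j≢e)) ⟨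
      ∣ (B ∩ C) ⊕ j ∣         ≡⟨ cong (λ D → ∣ D ⊕ j ∣) B∩C≡Q∩C ⟨
      ∣ ((B ⊖ e) ∩ C) ⊕ j ∣
        ≡⟨ cong ∣_∣ (trans (∩-updateˡ (B ⊖ e) C j inside) (cong (λ s → ((B ⊖ e) ∩ C) [ j ]≔ s) C?j)) ⟨
      ∣ (B ⊖ e ⊕ j) ∩ C ∣     ∎)))
      where open ≤-Reasoning

  -- The fundamental circuit of `e` in `B` stays within `C`. Without such a relation the columns of
  -- `B ⊕ e` would be independent, one more than the rank allows; this refutation gives existence
  -- only up to double negation.
  ⊢⇒spans : ∀ {C e B} → C ∌ e → C ⊢ e → Basis B → ∣ B ∩ C ∣ ≡ rk M C →
            B ∌ e × ¬ ¬ Spans (B ∩ C) e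
  ⊢⇒spans {C} {e} {B} C∌e C⊢e basis ∣B∩C∣≡rk with lookup B e in B?e
  ... | inside  = contradiction basis (>rk⇒¬Basis (C ⊕ e) (begin-strict
    rk M (C ⊕ e)     ≡⟨ C⊢e ⟩
    rk M C           ≡⟨ ∣B∩C∣≡rk ⟨
    ∣ B ∩ C ∣        <⟨ ℕₚ.n<1+n _ ⟩
    suc ∣ B ∩ C ∣    ≡⟨ ∣∩⊕∣-∋ B C B?e C∌e ⟨
    ∣ B ∩ (C ⊕ e) ∣  ∎))
    where open ≤-Reasoning
  ... | outside = refl , λ noSpan →
    ℕₚ.<⇒≱ (ℕₚ.≤-reflexive (trans (cong suc (basis-size basis)) (sym (∣⊕∣ B B?e))))
      (proj₂ hasRank (B ⊕ e) λ t supp t⊥A → independent noSpan t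
         (λ j j∌ → supp j λ j∈ → ∋⇒¬∌ (B ⊕ e) ([]=⇒lookup j∈) j∌) t⊥A)
    where
    module _ (noSpan : ¬ Spans (B ∩ C) e) (t : Fin n → Carrier)
             (supp : ∀ j → B ⊕ e ∌ j → t j ≈ 0#) (t⊥A : Relation A t) where

      -- Such a basis would meet `C ⊕ e` in one element more than its rank.
      nonbasis : ∀ b → C ∌ b → ¬ Basis (B ⊖ b ⊕ e)
      nonbasis b C∌b = >rk⇒¬Basis (C ⊕ e) (begin-strict
        rk M (C ⊕ e)                 ≡⟨ C⊢e ⟩
        rk M C                       ≡⟨ ∣B∩C∣≡rk ⟨
        ∣ B ∩ C ∣                    <⟨ ℕₚ.n<1+n _ ⟩
        suc ∣ B ∩ C ∣
          ≡⟨ cong (suc ∘ ∣_∣) (trans (∩-updateˡ B C b outside) (update-self (B ∩ C) b (∩-∌ʳ B C C∌b))) ⟨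
        suc ∣ (B ⊖ b) ∩ C ∣
          ≡⟨ cong (suc ∘ ∣_∣) (trans (∩-updateˡ (B ⊖ b) C e inside)
              (trans (cong (((B ⊖ b) ∩ C) [ e ]≔_) C∌e)
                (update-self ((B ⊖ b) ∩ C) e (∩-∌ʳ (B ⊖ b) C C∌e)))) ⟨
        suc ∣ (B ⊖ b ⊕ e) ∩ C ∣      ≡⟨ ∣∩⊕∣-∋ (B ⊖ b ⊕ e) C (lookup∘update e (B ⊖ b) inside) C∌e ⟨
        ∣ (B ⊖ b ⊕ e) ∩ (C ⊕ e) ∣    ∎)
        where open ≤-Reasoning

      -- Otherwise `t` is the excluded relation: at an element of `B` outside `C` it vanishes by
      -- `relation-at`, since exchanging that element for `e` gives no basis.
      te≈0 : t e ≈ 0#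
      te≈0 = ≈-stable λ te≉0 → noSpan (t , t⊥A , te≉0 , λ j B∩C∌j j≢e → vanish j B∩C∌j j≢e)
        where
        vanish : ∀ j → B ∩ C ∌ j → j ≢ e → t j ≈ 0#
        vanish j B∩C∌j j≢e with lookup B j in B?j
        ... | outside = supp j (⊕-∌ B B?j j≢e)
        ... | inside  = relation-at t⊥A basis B?j others
          where
          C∌j : C ∌ j
          C∌j = trans (cong (_∧ lookup C j) (sym B?j)) (trans (sym (lookup-zipWith _∧_ j B C)) B∩C∌j)
          others : ∀ i → B ⊖ j ∌ i → i ≢ j → t i ≈ 0# ⊎ p (B ⊖ j ⊕ i) ≈ 0#
          others i Q∌i i≢j with i Fin.≟ e
          ... | yes refl = inj₂ (swap-nonbasis basis B?j Q∌i (nonbasis j C∌j))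
          ... | no i≢e   = inj₁ (supp i (⊕-∌ B (∌-⊖ B Q∌i i≢j) i≢e))

      -- Now `t` is supported on the basis `B` alone, where `relation-at` kills every entry.
      independent : ∀ j → t j ≈ 0#
      independent j with j Fin.≟ e
      ... | yes refl = te≈0
      ... | no j≢e with lookup B j in B?j
      ...   | outside = supp j (⊕-∌ B B?j j≢e)
      ...   | inside  = relation-at t⊥A basis B?j others
        where
        others : ∀ i → B ⊖ j ∌ i → i ≢ j → t i ≈ 0# ⊎ p (B ⊖ j ⊕ i) ≈ 0#
        others i Q∌i i≢j with i Fin.≟ e
        ... | yes refl = inj₁ te≈0
        ... | no i≢e   = inj₁ (supp i (⊕-∌ B (∌-⊖ B Q∌i i≢j) i≢e))

  ⊢⇒¬¬Spans : ∀ {C e} → C ∌ e → C ⊢ e → ¬ ¬ Spans C e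
  ⊢⇒¬¬Spans {C} C∌e C⊢e noSpan with B , basis , eq ← rk-attained C =
    proj₂ (⊢⇒spans C∌e C⊢e basis eq) λ (t , t⊥A , te≉0 , supp) →
      noSpan (t , t⊥A , te≉0 , λ j C∌j → supp j (∩-∌ʳ B C C∌j))

  -- A relation supported on `C` and `e` is also supported on `D` and `e`. The inclusion is phrased
  -- through complements to match the support conditions.
  ⊢-mono : ∀ {C D e} → (∀ j → D ∌ j → C ∌ j) → C ⊢ e → D ⊢ e
  ⊢-mono {C} {D} {e} D∌⇒C∌ C⊢e with lookup D e in D?e
  ... | inside  = ∋⇒⊢ D D?e
  ... | outside = decidable-stable (D ⊢? e) λ D⊬e →
    ⊢⇒¬¬Spans (D∌⇒C∌ e D?e) C⊢e λ (t , t⊥A , te≉0 , supp) →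
      D⊬e (spans⇒⊢ D?e (t , t⊥A , te≉0 , λ j D∌j → supp j (D∌⇒C∌ j D∌j)))

-- Crossing chords in a positroid

-- The factor by which inserting `i` into a set changes the sign with which `j` enters it: minus
-- exactly when `i` precedes `j`.
before-sign : ∀ {n} → Fin n → Fin n → Sign
before-sign zero    zero    = Sign.+
before-sign zero    (suc j) = Sign.-
before-sign (suc i) zero    = Sign.+
before-sign (suc i) (suc j) = before-sign i j

opposite-* : ∀ s t → Sign.opposite (s Sign.* t) ≡ s Sign.* Sign.opposite t
opposite-* Sign.+ t = refl
opposite-* Sign.- t = refl

position-sign-⊕ : ∀ {n} (S : Subset n) {i j} → S ∌ i → j ≢ i →
                  position-sign (S ⊕ i) j ≡ before-sign i j Sign.* position-sign S j
position-sign-⊕ (outside ∷ S) {zero}  {zero}  S∌i j≢i = contradiction refl j≢i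
position-sign-⊕ (outside ∷ S) {zero}  {suc j} S∌i j≢i = refl
position-sign-⊕ (_ ∷ S)       {suc i} {zero}  S∌i j≢i = refl
position-sign-⊕ (outside ∷ S) {suc i} {suc j} S∌i j≢i = position-sign-⊕ S S∌i (j≢i ∘ cong suc)
position-sign-⊕ (inside ∷ S)  {suc i} {suc j} S∌i j≢i =
  trans (cong Sign.opposite (position-sign-⊕ S S∌i (j≢i ∘ cong suc)))
        (opposite-* (before-sign i j) (position-sign S j))

-- The chords {x, y} and {e, f} cross.
Crossing : ∀ {n} (x y e f : Fin n) → Set
Crossing x y e f =
  before-sign x e Sign.* before-sign x f ≡ Sign.opposite (before-sign y e Sign.* before-sign y f)

module OrderedField {c ℓ} (ℝ : Reals c ℓ) where
  open Reals ℝ hiding (zero; refl; sym; trans; _-_)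
  open Field ℝ
  open Forms commutativeRing
  open IsStrictTotalOrder isStrictTotalOrder
    using (<-respˡ-≈; <-respʳ-≈; irrefl) renaming (trans to <-trans)
  open import Algebra.Properties.Group +-group using (x∙y⁻¹≈ε⇒x≈y)
  open import Algebra.Solver.Ring.NaturalCoefficients.Default commutativeSemiring
  open import Relation.Binary.Reasoning.Setoid setoid

  +-pos : ∀ {x y} → 0# < x → 0# < y → 0# < x + y
  +-pos {x} {y} 0<x 0<y = <-trans 0<x (<-respˡ-≈ (+-identityʳ x) (+-monoʳ-< x 0<y))

  +-pos-nonneg : ∀ {x y} → 0# < x → 0# ≤ y → 0# < x + y
  +-pos-nonneg {x} 0<x (inj₁ 0<y) = +-pos 0<x 0<y
  +-pos-nonneg {x} 0<x (inj₂ 0≈y) = <-respʳ-≈ (≈.sym (≈.trans (+-congˡ (≈.sym 0≈y)) (+-identityʳ x))) 0<x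

  *-pos-nonneg : ∀ {x y} → 0# < x → 0# ≤ y → 0# ≤ x * y
  *-pos-nonneg     0<x (inj₁ 0<y) = inj₁ (*-pos 0<x 0<y)
  *-pos-nonneg {x} 0<x (inj₂ 0≈y) = inj₂ (≈.sym (≈.trans (*-congˡ (≈.sym 0≈y)) (zeroʳ x)))

  positive : ∀ {x} → 0# ≤ x → ¬ x ≈ 0# → 0# < x
  positive (inj₁ 0<x) x≉0 = 0<x
  positive (inj₂ 0≈x) x≉0 = contradiction (≈.sym 0≈x) x≉0

  -- Write b′ for `b` with sign `s`. Then `a * w` equals b′ times `x`, and `a * y` equals minus b′
  -- times `z`; eliminating `a` gives b′ times `z * w + x * y` equal to zero, although that sum is
  -- positive when `w` is. If `w` is zero, the first equation already kills `b`.
  no-opposite-relations : ∀ s {a b w x y z} →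
    0# ≤ w → 0# < x → 0# ≤ y → 0# < z → ¬ b ≈ 0# →
    a * w + signed (Sign.opposite s) (b * x) ≈ 0# → a * y + signed s (b * z) ≈ 0# → ⊥
  no-opposite-relations s {a} {b} {w} {x} {y} {z} 0≤w 0<x 0≤y 0<z b≉0 eq₁ eq₂ with 0≤w
  ... | inj₁ 0<w = irrefl ≈.refl (<-respʳ-≈ (cancel-nonzeroˡ b′≉0 product≈0)
                     (+-pos-nonneg (*-pos 0<z 0<w) (*-pos-nonneg 0<x 0≤y)))
    where
    b′ = signed s b
    b′≉0 : ¬ b′ ≈ 0#
    b′≉0 = b≉0 ∘ signed-zero⁻¹ s
    aw≈b′x : a * w ≈ b′ * x
    aw≈b′x = x∙y⁻¹≈ε⇒x≈y _ _ (begin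
      a * w + - (b′ * x)                        ≈⟨ +-congˡ (-‿cong (signed-*ˡ s b x)) ⟩
      a * w + - signed s (b * x)                ≈⟨ +-congˡ (signed-opposite s (b * x)) ⟩
      a * w + signed (Sign.opposite s) (b * x)  ≈⟨ eq₁ ⟩
      0#                                        ∎)
    product≈0 : b′ * (z * w + x * y) ≈ 0#
    product≈0 = begin
      b′ * (z * w + x * y)
        ≈⟨ solve 5 (λ b w x y z → b :* (z :* w :+ x :* y) := (b :* x) :* y :+ (b :* z) :* w)
             ≈.refl b′ w x y z ⟩
      (b′ * x) * y + (b′ * z) * w  ≈⟨ +-congʳ (*-congʳ aw≈b′x) ⟨
      (a * w) * y + (b′ * z) * w
        ≈⟨ solve 4 (λ a w y u → (a :* w) :* y :+ u :* w := (a :* y :+ u) :* w) ≈.refl a w y (b′ * z) ⟩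
      (a * y + b′ * z) * w         ≈⟨ *-congʳ (+-congˡ (signed-*ˡ s b z)) ⟩
      (a * y + signed s (b * z)) * w ≈⟨ *-congʳ eq₂ ⟩
      0# * w                       ≈⟨ zeroˡ w ⟩
      0#                           ∎
  ... | inj₂ 0≈w = irrefl ≈.refl (<-respʳ-≈ (cancel-nonzeroˡ b≉0 (signed-zero⁻¹ (Sign.opposite s) (begin
    signed (Sign.opposite s) (b * x)            ≈⟨ +-identityˡ _ ⟨
    0# + signed (Sign.opposite s) (b * x)       ≈⟨ +-congʳ (≈.trans (*-congˡ (≈.sym 0≈w)) (zeroʳ a)) ⟨
    a * w + signed (Sign.opposite s) (b * x)    ≈⟨ eq₁ ⟩
    0#                                          ∎))) 0<x)

  collect-signs : ∀ s t {x y} → signed s x + signed t y ≈ 0# → x + signed (s Sign.* t) y ≈ 0#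
  collect-signs s t {x} {y} eq = begin
    x + signed (s Sign.* t) y
      ≡⟨ cong (λ r → signed r x + signed (s Sign.* t) y) (Sign.s*s≡+ s) ⟨
    signed (s Sign.* s) x + signed (s Sign.* t) y ≈⟨ +-cong (signed-* s s x) (signed-* s t y) ⟨
    signed s (signed s x) + signed s (signed t y) ≈⟨ signed-+ s _ _ ⟨
    signed s (signed s x + signed t y)            ≈⟨ signed-zero s eq ⟩
    0#                                            ∎

module Positroid {c ℓ} (ℝ : Reals c ℓ) {n} (M : Matroid n) {d} (A : Matrix ℝ d n)
                 (hasRank : HasRank ℝ A d) (columnMatroid : IsColumnMatroid ℝ A M)
                 (nonnegative : NonnegativeMaximalMinors ℝ A) where
  open Reals ℝ hiding (zero; refl; sym; trans; _-_)
  open Field ℝ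
  open OrderedField ℝ
  open Forms commutativeRing
  open Minors ℝ
  open Matroid M
  open Rank M
  open Representation ℝ M A hasRank columnMatroid
  open IsStrictTotalOrder isStrictTotalOrder using (<-respʳ-≈)
  open CommutativeSemigroupProperties Sign.*-commutativeSemigroup
    using (interchange)

  p-nonneg : ∀ S → d ≡ ∣ S ∣ → 0# ≤ p S
  p-nonneg S e with nonnegative S e
  ... | inj₁ 0<m = inj₁ (<-respʳ-≈ (maximalMinor≈rowWedge A S e) 0<m)
  ... | inj₂ 0≈m = inj₂ (≈.trans 0≈m (maximalMinor≈rowWedge A S e))

  -- In M / C, x and y are parallel nonloops and e is a loop.
  noncrossing : ∀ {C x y e} → C ∌ x → C ∌ y → C ∌ e → y ≢ x → e ≢ x → e ≢ y →
    ¬ C ⊢ y → C ⊕ x ⊢ y → ¬ Loop M e → (∀ f → C ∋ f → Crossing x y e f) → ¬ C ⊢ e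
  noncrossing {C} {x} {y} {e} C∌x C∌y C∌e y≢x e≢x e≢y C⊬y C⊕x⊢y ¬loop crossing C⊢e
    with B , basis , ∣B∩∣≡rk ← rk-attained (C ⊕ x) with lookup B x in B?x
  -- `B` must contain `x`, because `C ⊕ x` has larger rank than `C`: from `C ⊢ x`, transitivity
  -- would give `C ⊢ y`.
  ... | outside = ℕₚ.<⇒≱ (⊬⇒rk< (λ C⊢x → C⊬y (⊢-trans C⊢x C⊕x⊢y)))
                    (subst (ℕ._≤ rk M C) (trans (sym (cong ∣_∣ (∩⊕-∌ B C B?x))) ∣B∩∣≡rk) (∣B∩S∣≤rk basis C))
  ... | inside  =
    proj₂ (⊢⇒spans C∌e C⊢e basis ∣B∩C∣≡rk) λ t →
    proj₂ (⊢⇒spans (⊕-∌ C C∌y y≢x) C⊕x⊢y basis ∣B∩∣≡rk) λ u → clash t u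
    where
    -- `B` is thus maximal on `C` as well as on `C ⊕ x`, so one basis serves for both relations.
    ∣B∩C∣≡rk : ∣ B ∩ C ∣ ≡ rk M C
    ∣B∩C∣≡rk = ℕₚ.≤-antisym (∣B∩S∣≤rk basis C) (ℕₚ.≤-pred (begin
      suc (rk M C)     ≤⟨ ⊬⇒rk< (λ C⊢x → C⊬y (⊢-trans C⊢x C⊕x⊢y)) ⟩
      rk M (C ⊕ x)     ≡⟨ ∣B∩∣≡rk ⟨
      ∣ B ∩ (C ⊕ x) ∣  ≡⟨ ∣∩⊕∣-∋ B C B?x C∌x ⟩
      suc ∣ B ∩ C ∣    ∎))
      where open ≤-Reasoning

    B∌e = proj₁ (⊢⇒spans C∌e C⊢e basis ∣B∩C∣≡rk)
    B∌y = proj₁ (⊢⇒spans (⊕-∌ C C∌y y≢x) C⊕x⊢y basis ∣B∩∣≡rk)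

    clash : Spans (B ∩ C) e → Spans (B ∩ (C ⊕ x)) y → ⊥
    clash (t , t⊥A , te≉0 , t-supp) (u , u⊥A , uy≉0 , u-supp) =
      -- Once `t` vanishes away from `e`, a basis containing `e` would force `t e` to vanish, so `e`
      -- would be a loop.
      ¬loop λ B′ basis′ e∈B′ → te≉0 (relation-at t⊥A basis′ ([]=⇒lookup e∈B′) λ j _ j≢e → inj₁ (tj≈0 j j≢e))
      where
      ux≉0 : ¬ u x ≈ 0#
      ux≉0 ux≈0 = C⊬y (spans⇒⊢ C∌y (u , u⊥A , uy≉0 , vanish))
        where
        vanish : ∀ j → C ∌ j → j ≢ y → u j ≈ 0#
        vanish j C∌j j≢y with j Fin.≟ x
        ... | yes refl = ux≈0
        ... | no j≢x   = u-supp j (∩-∌ʳ B (C ⊕ x) (⊕-∌ C C∌j j≢x)) j≢y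

      -- For such an `f` the two-term relations at `Q ⊕ x` and `Q ⊕ y` contradict each other: the
      -- minors with `f` belong to `B` and to `B ⊖ x ⊕ y`, both nonzero, and the signs are opposite.
      module _ (f : Fin n) (B∋f : B ∋ f) (C∋f : C ∋ f) (tf≉0 : ¬ t f ≈ 0#) where
        f≢x = ∋∌⇒≢ C C∋f C∌x
        f≢y = ∋∌⇒≢ C C∋f C∌y
        f≢e = ∋∌⇒≢ C C∋f C∌e

        Q : Subset n
        Q = B ⊖ x ⊖ f

        Q∌x : Q ∌ x
        Q∌x = ⊖-∌ (B ⊖ x) (lookup∘update x B outside)
        Q∌f : Q ∌ f
        Q∌f = lookup∘update f (B ⊖ x) outside
        Q∌y : Q ∌ y
        Q∌y = ⊖-∌ (B ⊖ x) (⊖-∌ B B∌y)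
        Q∌e : Q ∌ e
        Q∌e = ⊖-∌ (B ⊖ x) (⊖-∌ B B∌e)

        Q⊕x≡B⊖f : Q ⊕ x ≡ B ⊖ f
        Q⊕x≡B⊖f = trans (cong (_⊕ x) ([]≔-commutes B x f (f≢x ∘ sym)))
                        (⊖-⊕ (B ⊖ f) (trans (lookup∘update′ (f≢x ∘ sym) B outside) B?x))
        Q⊕f≡B⊖x : Q ⊕ f ≡ B ⊖ x
        Q⊕f≡B⊖x = ⊖-⊕ (B ⊖ x) (trans (lookup∘update′ f≢x B outside) B∋f)
        Q⊕x⊕f≡B : Q ⊕ x ⊕ f ≡ B
        Q⊕x⊕f≡B = trans (cong (_⊕ f) Q⊕x≡B⊖f) (⊖-⊕ B B∋f)
        Q⊕y⊕f≡B⊖x⊕y : Q ⊕ y ⊕ f ≡ B ⊖ x ⊕ y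
        Q⊕y⊕f≡B⊖x⊕y = trans (⊕-comm Q y f) (cong (_⊕ y) Q⊕f≡B⊖x)

        vanish : ∀ z j → Q ⊕ z ∌ j → j ≢ e → j ≢ f → t j * p (Q ⊕ z ⊕ j) ≈ 0#
        vanish z j Q⊕z∌j j≢e j≢f = ≈.trans (*-congʳ (t-supp j B∩C∌j j≢e)) (zeroˡ _)
          where
          B∩C∌j : B ∩ C ∌ j
          B∩C∌j with j Fin.≟ x
          ... | yes refl = ∩-∌ʳ B C C∌x
          ... | no j≢x   = ∩-∌ˡ B C (∌-⊖ B (∌-⊖ (B ⊖ x) (∌-⊕ Q Q⊕z∌j) j≢f) j≢x)

        size-Q⊕y⊕f : d ≡ ∣ Q ⊕ y ⊕ f ∣
        size-Q⊕y⊕f = trans (basis-size basis)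
          (trans (sym (∣swap∣ B B?x (⊖-∌ B B∌y))) (cong ∣_∣ (sym Q⊕y⊕f≡B⊖x⊕y)))

        size-Q⊕⊕e : ∀ z → e ≢ z → f ≢ z → d ≡ ∣ Q ⊕ z ⊕ f ∣ → d ≡ ∣ Q ⊕ z ⊕ e ∣
        size-Q⊕⊕e z e≢z f≢z eq = trans eq
          (trans (∣⊕∣ (Q ⊕ z) (⊕-∌ Q Q∌f f≢z)) (sym (∣⊕∣ (Q ⊕ z) (⊕-∌ Q Q∌e e≢z))))

        -- If exchanging `x` for `y` gave a zero minor, `relation-at` would kill `u x`.
        pQyf≉0 : ¬ p (Q ⊕ y ⊕ f) ≈ 0#
        pQyf≉0 p≈0 = ux≉0 (relation-at u⊥A basis B?x others)
          where
          others : ∀ j → B ⊖ x ∌ j → j ≢ x → u j ≈ 0# ⊎ p (B ⊖ x ⊕ j) ≈ 0#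
          others j B⊖x∌j j≢x with j Fin.≟ y
          ... | yes refl = inj₂ (subst (λ S → p S ≈ 0#) Q⊕y⊕f≡B⊖x⊕y p≈0)
          ... | no j≢y   = inj₁ (u-supp j (∩-∌ˡ B (C ⊕ x) (∌-⊖ B B⊖x∌j j≢x)) j≢y)

        size-Q⊕x⊕f : d ≡ ∣ Q ⊕ x ⊕ f ∣
        size-Q⊕x⊕f = trans (basis-size basis) (cong ∣_∣ (sym Q⊕x⊕f≡B))

        signs : Fin n → Sign
        signs z = position-sign (Q ⊕ z) e Sign.* position-sign (Q ⊕ z) f

        relation : ∀ z → e ≢ z → f ≢ z → t e * p (Q ⊕ z ⊕ e) + signed (signs z) (t f * p (Q ⊕ z ⊕ f)) ≈ 0#
        relation z e≢z f≢z = collect-signs (position-sign (Q ⊕ z) e) (position-sign (Q ⊕ z) f)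
          (two-term-relation A t⊥A (Q ⊕ z) e f (⊕-∌ Q Q∌e e≢z) (⊕-∌ Q Q∌f f≢z) f≢e (vanish z))

        signs-split : ∀ z → Q ∌ z → e ≢ z → f ≢ z → signs z ≡
          (before-sign z e Sign.* before-sign z f) Sign.* (position-sign Q e Sign.* position-sign Q f)
        signs-split z Q∌z e≢z f≢z =
          trans (cong₂ Sign._*_ (position-sign-⊕ Q Q∌z e≢z) (position-sign-⊕ Q Q∌z f≢z))
                (interchange (before-sign z e) _ (before-sign z f) _)

        -- `Q` contributes the same factor on both sides; only the position of `x` or `y` relative
        -- to `e` and `f` differs.
        opposite-signs : signs x ≡ Sign.opposite (signs y)
        opposite-signs = begin
          signs x                                   ≡⟨ signs-split x Q∌x e≢x f≢x ⟩
          (before-sign x e Sign.* before-sign x f) Sign.* q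
                                                    ≡⟨ cong (Sign._* q) (crossing f C∋f) ⟩
          Sign.opposite r Sign.* q                  ≡⟨ Sign.*-comm (Sign.opposite r) q ⟩
          q Sign.* Sign.opposite r                  ≡⟨ opposite-* q r ⟨
          Sign.opposite (q Sign.* r)                ≡⟨ cong Sign.opposite (Sign.*-comm q r) ⟩
          Sign.opposite (r Sign.* q)                ≡⟨ cong Sign.opposite (signs-split y Q∌y e≢y f≢y) ⟨
          Sign.opposite (signs y)                   ∎
          where
          open ≡-Reasoning
          q = position-sign Q e Sign.* position-sign Q f
          r = before-sign y e Sign.* before-sign y f

        absurd : ⊥
        absurd = no-opposite-relations (signs y)
          (p-nonneg (Q ⊕ x ⊕ e) (size-Q⊕⊕e x e≢x f≢x size-Q⊕x⊕f))
          (positive (p-nonneg (Q ⊕ x ⊕ f) size-Q⊕x⊕f)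
            (subst (λ S → ¬ p S ≈ 0#) (sym Q⊕x⊕f≡B) (basis⇒p≉0 basis)))
          (p-nonneg (Q ⊕ y ⊕ e) (size-Q⊕⊕e y e≢y f≢y size-Q⊕y⊕f))
          (positive (p-nonneg (Q ⊕ y ⊕ f) size-Q⊕y⊕f) pQyf≉0)
          tf≉0
          (subst (λ s → t e * p (Q ⊕ x ⊕ e) + signed s (t f * p (Q ⊕ x ⊕ f)) ≈ 0#)
            opposite-signs (relation x e≢x f≢x))
          (relation y e≢y f≢y)

      tj≈0 : ∀ j → j ≢ e → t j ≈ 0#
      tj≈0 j j≢e with lookup B j in B?j | lookup C j in C?j
      ... | outside | _       = t-supp j (∩-∌ˡ B C B?j) j≢e
      ... | inside  | outside = t-supp j (∩-∌ʳ B C C?j) j≢e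
      ... | inside  | inside  = ≈-stable (absurd j B?j C?j)

-- Cyclic positions and intervals

-- Reaching `x` from `a` in `d` steps, with at most one wrap. Equations between sums avoid truncated
-- subtraction and remainders.
Steps : ∀ {n} → Fin n → Fin n → ℕ → Set
Steps {n} a x d = toℕ a ℕ.+ d ≡ toℕ x ⊎ toℕ a ℕ.+ d ≡ toℕ x ℕ.+ n

private
  open CommutativeSemigroupProperties ℕₚ.+-commutativeSemigroup using (xy∙z≈xz∙y)

  no-excess : ∀ {x n} y → x ℕ.< n → x ≢ y ℕ.+ n
  no-excess y x<n refl = ℕₚ.<⇒≱ x<n (ℕₚ.m≤n+m _ y)

position-steps : ∀ {n} (a x : Fin n) → Steps a x (position a x)
position-steps {n} a x with toℕ a ℕ.≤ᵇ toℕ x | ℕₚ.≤ᵇ-reflects-≤ (toℕ a) (toℕ x)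
... | true  | ofʸ a≤x = inj₁ (ℕₚ.m+[n∸m]≡n a≤x)
... | false | ofⁿ a≰x = inj₂ (begin
  toℕ a ℕ.+ (n ℕ.∸ toℕ a ℕ.+ toℕ x)    ≡⟨ ℕₚ.+-assoc (toℕ a) _ _ ⟨
  (toℕ a ℕ.+ (n ℕ.∸ toℕ a)) ℕ.+ toℕ x  ≡⟨ cong (ℕ._+ toℕ x) (ℕₚ.m+[n∸m]≡n (ℕₚ.<⇒≤ (Fin.toℕ<n a))) ⟩
  n ℕ.+ toℕ x                          ≡⟨ ℕₚ.+-comm n (toℕ x) ⟩
  toℕ x ℕ.+ n                          ∎)
  where open ≡-Reasoning

position<n : ∀ {n} (a x : Fin n) → position a x ℕ.< n
position<n {n} a x with toℕ a ℕ.≤ᵇ toℕ x | ℕₚ.≤ᵇ-reflects-≤ (toℕ a) (toℕ x)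
... | true  | ofʸ a≤x = ℕₚ.≤-<-trans (ℕₚ.m∸n≤m (toℕ x) (toℕ a)) (Fin.toℕ<n x)
... | false | ofⁿ a≰x = begin-strict
  n ℕ.∸ toℕ a ℕ.+ toℕ x  <⟨ ℕₚ.+-monoʳ-< (n ℕ.∸ toℕ a) (ℕₚ.≰⇒> a≰x) ⟩
  n ℕ.∸ toℕ a ℕ.+ toℕ a  ≡⟨ ℕₚ.m∸n+n≡m (ℕₚ.<⇒≤ (Fin.toℕ<n a)) ⟩
  n                      ∎
  where open ≤-Reasoning

steps-unique : ∀ {n} (a x : Fin n) {d d′} → d ℕ.< n → d′ ℕ.< n → Steps a x d → Steps a x d′ → d ≡ d′
steps-unique a x d<n d′<n (inj₁ p) (inj₁ q) = ℕₚ.+-cancelˡ-≡ (toℕ a) _ _ (trans p (sym q))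
steps-unique a x d<n d′<n (inj₂ p) (inj₂ q) = ℕₚ.+-cancelˡ-≡ (toℕ a) _ _ (trans p (sym q))
steps-unique {n} a x {d} {d′} d<n d′<n (inj₁ p) (inj₂ q) = contradiction
  (ℕₚ.+-cancelˡ-≡ (toℕ a) _ _ (trans q (trans (cong (ℕ._+ n) (sym p)) (ℕₚ.+-assoc (toℕ a) d n))))
  (no-excess d d′<n)
steps-unique {n} a x {d} {d′} d<n d′<n (inj₂ p) (inj₁ q) = contradiction
  (ℕₚ.+-cancelˡ-≡ (toℕ a) _ _ (trans p (trans (cong (ℕ._+ n) (sym q)) (ℕₚ.+-assoc (toℕ a) d′ n))))
  (no-excess d′ d<n)

position-unique : ∀ {n} (a x : Fin n) {d} → d ℕ.< n → Steps a x d → position a x ≡ d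
position-unique a x d<n steps = steps-unique a x (position<n a x) d<n (position-steps a x) steps

position-self : ∀ {n} (a : Fin n) → position a a ≡ 0
position-self a = position-unique a a (ℕₚ.≤-<-trans ℕ.z≤n (Fin.toℕ<n a)) (inj₁ (ℕₚ.+-identityʳ (toℕ a)))

-- Change of origin. Together with `position-rebase->` it reduces cyclic comparisons to arithmetic
-- on positions counted from one common origin.
position-rebase-≤ : ∀ {n} (o b z : Fin n) → position o b ℕ.≤ position o z →
                    position b z ℕ.+ position o b ≡ position o z
position-rebase-≤ {n} o b z p≤q = begin
  position b z ℕ.+ p
    ≡⟨ cong (ℕ._+ p) (position-unique b z r<n (steps (position-steps o b) (position-steps o z))) ⟩
  r ℕ.+ p             ≡⟨ ℕₚ.m∸n+n≡m p≤q ⟩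
  q                   ∎
  where
  open ≡-Reasoning
  p = position o b
  q = position o z
  r = q ℕ.∸ p
  r<n = ℕₚ.≤-<-trans (ℕₚ.m∸n≤m q p) (position<n o z)

  o+p+r : (toℕ o ℕ.+ p) ℕ.+ r ≡ toℕ o ℕ.+ q
  o+p+r = trans (ℕₚ.+-assoc (toℕ o) p r) (cong (toℕ o ℕ.+_) (ℕₚ.m+[n∸m]≡n p≤q))

  steps : Steps o b p → Steps o z q → Steps b z r
  steps (inj₁ op) (inj₁ oq) = inj₁ (trans (cong (ℕ._+ r) (sym op)) (trans o+p+r oq))
  steps (inj₁ op) (inj₂ oq) = inj₂ (trans (cong (ℕ._+ r) (sym op)) (trans o+p+r oq))
  steps (inj₂ op) (inj₁ oq) = contradiction
    (trans (sym oq) (trans (sym o+p+r) (trans (cong (ℕ._+ r) op) (xy∙z≈xz∙y (toℕ b) n r))))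
    (no-excess _ (Fin.toℕ<n z))
  steps (inj₂ op) (inj₂ oq) = inj₁ (ℕₚ.+-cancelʳ-≡ n _ _
    (trans (sym (xy∙z≈xz∙y (toℕ b) n r)) (trans (cong (ℕ._+ r) (sym op)) (trans o+p+r oq))))

-- The way from `b` to `z` now passes `o`, which costs one full turn.
position-rebase-> : ∀ {n} (o b z : Fin n) → position o z ℕ.< position o b →
                    position b z ℕ.+ position o b ≡ position o z ℕ.+ n
position-rebase-> {n} o b z q<p = begin
  position b z ℕ.+ p
    ≡⟨ cong (ℕ._+ p) (position-unique b z r<n (steps (position-steps o b) (position-steps o z))) ⟩
  r ℕ.+ p             ≡⟨ ℕₚ.m∸n+n≡m p≤q+n ⟩
  q ℕ.+ n             ∎
  where
  open ≡-Reasoning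
  p = position o b
  q = position o z
  r = q ℕ.+ n ℕ.∸ p
  p≤q+n = ℕₚ.≤-trans (ℕₚ.<⇒≤ (position<n o b)) (ℕₚ.m≤n+m n q)
  r<n : r ℕ.< n
  r<n = ℕₚ.+-cancelʳ-< p r n (ℕₚ.<-≤-trans
    (subst (ℕ._< p ℕ.+ n) (sym (ℕₚ.m∸n+n≡m p≤q+n)) (ℕₚ.+-monoˡ-< n q<p)) (ℕₚ.≤-reflexive (ℕₚ.+-comm p n)))

  o+p+r : (toℕ o ℕ.+ p) ℕ.+ r ≡ (toℕ o ℕ.+ q) ℕ.+ n
  o+p+r = trans (ℕₚ.+-assoc (toℕ o) p r)
    (trans (cong (toℕ o ℕ.+_) (ℕₚ.m+[n∸m]≡n p≤q+n)) (sym (ℕₚ.+-assoc (toℕ o) q n)))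

  steps : Steps o b p → Steps o z q → Steps b z r
  steps (inj₁ op) (inj₁ oq) = inj₂ (trans (cong (ℕ._+ r) (sym op)) (trans o+p+r (cong (ℕ._+ n) oq)))
  steps (inj₁ op) (inj₂ oq) = contradiction
    (trans (cong (ℕ._+ r) (sym op)) (trans o+p+r (cong (ℕ._+ n) oq)))
    (ℕₚ.<⇒≢ (ℕₚ.<-≤-trans (ℕₚ.+-mono-< (Fin.toℕ<n b) r<n) (ℕₚ.+-monoˡ-≤ n (ℕₚ.m≤n+m n (toℕ z)))))
  steps (inj₂ op) oq = finish oq
    where
    b+r≡o+q : toℕ b ℕ.+ r ≡ toℕ o ℕ.+ q
    b+r≡o+q = ℕₚ.+-cancelʳ-≡ n _ _ (trans (sym (xy∙z≈xz∙y (toℕ b) n r)) (trans (cong (ℕ._+ r) (sym op)) o+p+r))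
    finish : Steps o z q → Steps b z r
    finish (inj₁ oq) = inj₁ (trans b+r≡o+q oq)
    finish (inj₂ oq) = inj₂ (trans b+r≡o+q oq)

position-injective : ∀ {n} (o : Fin n) {b z} → position o b ≡ position o z → b ≡ z
position-injective {n} o {b} {z} eq with position-steps b z
  | ℕₚ.+-cancelʳ-≡ (position o b) (position b z) 0
      (trans (position-rebase-≤ o b z (ℕₚ.≤-reflexive eq)) (sym eq))
... | inj₁ b+0 | bz≡0 =
  Fin.toℕ-injective (trans (sym (ℕₚ.+-identityʳ _)) (trans (cong (toℕ b ℕ.+_) (sym bz≡0)) b+0))
... | inj₂ b+0 | bz≡0 = contradiction
  (trans (sym (ℕₚ.+-identityʳ _)) (trans (cong (toℕ b ℕ.+_) (sym bz≡0)) b+0))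
  (no-excess (toℕ z) (Fin.toℕ<n b))

position-surjective : ∀ {n} (o : Fin n) {m} → m ℕ.< n → ∃[ b ] position o b ≡ m
position-surjective {n} o {m} m<n with toℕ o ℕ.+ m ℕₚ.<? n
... | yes o+m<n = fromℕ< o+m<n , position-unique o _ m<n (inj₁ (sym (Fin.toℕ-fromℕ< o+m<n)))
... | no  o+m≮n = fromℕ< r<n , position-unique o _ m<n (inj₂ (begin
  toℕ o ℕ.+ m                    ≡⟨ ℕₚ.m∸n+n≡m n≤o+m ⟨
  (toℕ o ℕ.+ m ℕ.∸ n) ℕ.+ n      ≡⟨ cong (ℕ._+ n) (Fin.toℕ-fromℕ< r<n) ⟨
  toℕ (fromℕ< r<n) ℕ.+ n         ∎))
  where
  open ≡-Reasoning
  n≤o+m = ℕₚ.≮⇒≥ o+m≮n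
  r<n : toℕ o ℕ.+ m ℕ.∸ n ℕ.< n
  r<n = ℕₚ.+-cancelʳ-< n _ n
    (subst (ℕ._< n ℕ.+ n) (sym (ℕₚ.m∸n+n≡m n≤o+m)) (ℕₚ.+-mono-< (Fin.toℕ<n o) m<n))

position-pos : ∀ {n} (o : Fin n) {z} → z ≢ o → 0 ℕ.< position o z
position-pos o z≢o = ℕₚ.n≢0⇒n>0 λ eq → z≢o (sym (position-injective o (trans (position-self o) (sym eq))))

toℕ-next : ∀ {n} (a : Fin (suc n)) → toℕ (next a) ≡ suc (toℕ a) ⊎ (toℕ (next a) ≡ 0 × toℕ a ≡ n)
toℕ-next {n} a with ℕₚ.m≤n⇒m<n∨m≡n (Fin.toℕ<n a)
... | inj₁ 1+a<n = inj₁ (trans (Fin.toℕ-fromℕ< _) (m<n⇒m%n≡m 1+a<n))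
... | inj₂ 1+a≡n = inj₂
  (trans (Fin.toℕ-fromℕ< _) (trans (cong (_% suc n) 1+a≡n) (n%n≡0 (suc n))) , ℕₚ.suc-injective 1+a≡n)

position-next : ∀ {n} (a : Fin n) {z} → z ≢ a → suc (position (next a) z) ≡ position a z
position-next {suc n} a {z} z≢a with position a z | position-pos a z≢a | position<n a z | position-steps a z
... | suc r | _ | r<n | steps =
  cong suc (position-unique (next a) z (ℕₚ.<-trans (ℕₚ.n<1+n r) r<n) (shift (toℕ-next a) steps))
  where
  shift : toℕ (next a) ≡ suc (toℕ a) ⊎ (toℕ (next a) ≡ 0 × toℕ a ≡ n) →
          Steps a z (suc r) → Steps (next a) z r
  shift (inj₁ eq) (inj₁ st) = inj₁ (trans (cong (ℕ._+ r) eq) (trans (sym (ℕₚ.+-suc (toℕ a) r)) st))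
  shift (inj₁ eq) (inj₂ st) = inj₂ (trans (cong (ℕ._+ r) eq) (trans (sym (ℕₚ.+-suc (toℕ a) r)) st))
  shift (inj₂ (eq , a≡n)) st = wrap st
    where
    a+1+r≡r+1+n : toℕ a ℕ.+ suc r ≡ r ℕ.+ suc n
    a+1+r≡r+1+n = trans (cong (ℕ._+ suc r) a≡n) (trans (ℕₚ.+-suc n r)
      (trans (cong suc (ℕₚ.+-comm n r)) (sym (ℕₚ.+-suc r n))))
    wrap : Steps a z (suc r) → Steps (next a) z r
    wrap (inj₁ st) = contradiction (trans (sym st) a+1+r≡r+1+n) (no-excess r (Fin.toℕ<n z))
    wrap (inj₂ st) = inj₁ (trans (cong (ℕ._+ r) eq)
      (ℕₚ.+-cancelʳ-≡ (suc n) _ _ (trans (sym a+1+r≡r+1+n) st)))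

before-sign-< : ∀ {n} {i j : Fin n} → toℕ i ℕ.< toℕ j → before-sign i j ≡ Sign.-
before-sign-< {i = zero}  {suc j} _           = refl
before-sign-< {i = suc i} {suc j} (ℕ.s≤s i<j) = before-sign-< i<j

before-sign-≥ : ∀ {n} {i j : Fin n} → toℕ j ℕ.≤ toℕ i → before-sign i j ≡ Sign.+
before-sign-≥ {i = zero}  {zero}  _           = refl
before-sign-≥ {i = suc i} {zero}  _           = refl
before-sign-≥ {i = suc i} {suc j} (ℕ.s≤s j≤i) = before-sign-≥ j≤i

module _ {n} (x : Fin n) where
  private
    module _ {b z : Fin n} (p<q : position x b ℕ.< position x z) where
      x+p<x+q = ℕₚ.+-monoʳ-< (toℕ x) p<q

      unwrapped-< : toℕ x ℕ.+ position x b ≡ toℕ b → toℕ x ℕ.+ position x z ≡ toℕ z → toℕ b ℕ.< toℕ z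
      unwrapped-< b≡ z≡ = subst₂ ℕ._<_ b≡ z≡ x+p<x+q

      wrapped-< : toℕ x ℕ.+ position x b ≡ toℕ b ℕ.+ n → toℕ x ℕ.+ position x z ≡ toℕ z ℕ.+ n →
                  toℕ b ℕ.< toℕ z
      wrapped-< b≡ z≡ = ℕₚ.+-cancelʳ-< n _ _ (subst₂ ℕ._<_ b≡ z≡ x+p<x+q)

      wrapped-stays : toℕ x ℕ.+ position x b ≡ toℕ b ℕ.+ n → toℕ x ℕ.+ position x z ≢ toℕ z
      wrapped-stays b≡ z≡ = ℕₚ.<⇒≱ (Fin.toℕ<n z)
        (ℕₚ.≤-trans (ℕₚ.m≤n+m n (toℕ b)) (ℕₚ.<⇒≤ (subst₂ ℕ._<_ b≡ z≡ x+p<x+q)))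

    x≤unwrapped : ∀ {z} → toℕ x ℕ.+ position x z ≡ toℕ z → toℕ x ℕ.≤ toℕ z
    x≤unwrapped z≡ = subst (toℕ x ℕ.≤_) z≡ (ℕₚ.m≤m+n (toℕ x) _)

    wrapped<x : ∀ {z} → toℕ x ℕ.+ position x z ≡ toℕ z ℕ.+ n → toℕ z ℕ.< toℕ x
    wrapped<x {z} z≡ = ℕₚ.+-cancelʳ-< n _ _
      (subst (ℕ._< toℕ x ℕ.+ n) z≡ (ℕₚ.+-monoʳ-< (toℕ x) (position<n x z)))

  -- Seen from `x`, once an element has wrapped past the end all later ones have too. This leaves
  -- four cases for `e`, `y` and `f`, in each of which the four signs are explicit.
  crossing : ∀ {e y f} → e ≢ x → position x e ℕ.< position x y → position x y ℕ.< position x f →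
             Crossing x y e f
  crossing {e} {y} {f} e≢x pe<py py<pf = go (position-steps x e) (position-steps x y) (position-steps x f)
    where
    signs : ∀ {s₁ s₂ s₃ s₄} → before-sign x e ≡ s₁ → before-sign x f ≡ s₂ → before-sign y e ≡ s₃ →
            before-sign y f ≡ s₄ → s₁ Sign.* s₂ ≡ Sign.opposite (s₃ Sign.* s₄) → Crossing x y e f
    signs refl refl refl refl eq = eq

    go : Steps x e (position x e) → Steps x y (position x y) → Steps x f (position x f) → Crossing x y e f
    go (inj₁ e≡) (inj₁ y≡) (inj₁ f≡) = signs
      (before-sign-< (ℕₚ.≤∧≢⇒< (x≤unwrapped e≡) (e≢x ∘ sym ∘ Fin.toℕ-injective)))
      (before-sign-< (ℕₚ.≤-<-trans (x≤unwrapped y≡) (unwrapped-< py<pf y≡ f≡)))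
      (before-sign-≥ (ℕₚ.<⇒≤ (unwrapped-< pe<py e≡ y≡)))
      (before-sign-< (unwrapped-< py<pf y≡ f≡)) refl
    go (inj₁ e≡) (inj₁ y≡) (inj₂ f≡) = signs
      (before-sign-< (ℕₚ.≤∧≢⇒< (x≤unwrapped e≡) (e≢x ∘ sym ∘ Fin.toℕ-injective)))
      (before-sign-≥ (ℕₚ.<⇒≤ (wrapped<x f≡)))
      (before-sign-≥ (ℕₚ.<⇒≤ (unwrapped-< pe<py e≡ y≡)))
      (before-sign-≥ (ℕₚ.≤-trans (ℕₚ.<⇒≤ (wrapped<x f≡)) (x≤unwrapped y≡))) refl
    go (inj₁ e≡) (inj₂ y≡) (inj₂ f≡) = signs
      (before-sign-< (ℕₚ.≤∧≢⇒< (x≤unwrapped e≡) (e≢x ∘ sym ∘ Fin.toℕ-injective)))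
      (before-sign-≥ (ℕₚ.<⇒≤ (wrapped<x f≡)))
      (before-sign-< (ℕₚ.<-≤-trans (wrapped<x y≡) (x≤unwrapped e≡)))
      (before-sign-< (wrapped-< py<pf y≡ f≡)) refl
    go (inj₂ e≡) (inj₂ y≡) (inj₂ f≡) = signs
      (before-sign-≥ (ℕₚ.<⇒≤ (wrapped<x e≡)))
      (before-sign-≥ (ℕₚ.<⇒≤ (wrapped<x f≡)))
      (before-sign-≥ (ℕₚ.<⇒≤ (wrapped-< pe<py e≡ y≡)))
      (before-sign-< (wrapped-< py<pf y≡ f≡)) refl
    go (inj₂ e≡) (inj₁ y≡) _         = contradiction y≡ (wrapped-stays pe<py e≡)
    go _         (inj₂ y≡) (inj₁ f≡) = contradiction f≡ (wrapped-stays py<pf y≡)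

-- Cyclic intervals as subsets

module _ {n} {P : Pred (Fin n) 0ℓ} (P? : Decidable P) where
  private
    S = tabulate (λ z → does (P? z))

  comprehension-∋ : ∀ {z} → P z → S ∋ z
  comprehension-∋ {z} Pz = trans (lookup∘tabulate _ z) (dec-true (P? z) Pz)

  comprehension-∌ : ∀ {z} → ¬ P z → S ∌ z
  comprehension-∌ {z} ¬Pz = trans (lookup∘tabulate _ z) (dec-false (P? z) ¬Pz)

  ∋-comprehension : ∀ {z} → S ∋ z → P z
  ∋-comprehension {z} S∋z with P? z in eq
  ... | yes Pz = Pz
  ... | no ¬Pz = contradiction (comprehension-∌ ¬Pz) (∋⇒¬∌ S S∋z)

  ∌-comprehension : ∀ {z} → S ∌ z → ¬ P z
  ∌-comprehension S∌z Pz = ∋⇒¬∌ S (comprehension-∋ Pz) S∌z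

subset-ext : ∀ {n} {S T : Subset n} → (∀ j → lookup S j ≡ lookup T j) → S ≡ T
subset-ext {S = S} {T} eq = trans (sym (tabulate∘lookup S)) (trans (tabulate-cong eq) (tabulate∘lookup T))

module _ {n} (a b : Fin n) where
  private
    inInterval? : Decidable (λ z → position a z ℕ.≤ position a b)
    inInterval? z = position a z ℕₚ.≤? position a b

  interval-∋ : ∀ {z} → position a z ℕ.≤ position a b → [ a , b ] ∋ z
  interval-∋ = comprehension-∋ inInterval?

  ∋-interval : ∀ {z} → [ a , b ] ∋ z → position a z ℕ.≤ position a b
  ∋-interval = ∋-comprehension inInterval?

  interval-∌ : ∀ {z} → position a b ℕ.< position a z → [ a , b ] ∌ z
  interval-∌ = comprehension-∌ inInterval? ∘ ℕₚ.<⇒≱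

-- For m = 1 + position o y this is the complement of [ o , y ].
final : ∀ {n} → Fin n → ℕ → Subset n
final o m = tabulate (λ z → does (m ℕₚ.≤? position o z))

module _ {n} (o : Fin n) (m : ℕ) where
  private
    inFinal? : Decidable (λ z → m ℕ.≤ position o z)
    inFinal? z = m ℕₚ.≤? position o z

  final-∋ : ∀ {z} → m ℕ.≤ position o z → final o m ∋ z
  final-∋ = comprehension-∋ inFinal?

  ∋-final : ∀ {z} → final o m ∋ z → m ℕ.≤ position o z
  ∋-final = ∋-comprehension inFinal?

  final-∌ : ∀ {z} → position o z ℕ.< m → final o m ∌ z
  final-∌ = comprehension-∌ inFinal? ∘ ℕₚ.<⇒≱

  ∌-final : ∀ {z} → final o m ∌ z → position o z ℕ.< m
  ∌-final = ℕₚ.≰⇒> ∘ ∌-comprehension inFinal?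

final-⊕ : ∀ {n} (o b : Fin n) → final o (suc (position o b)) ⊕ b ≡ final o (position o b)
final-⊕ o b = subset-ext same
  where
  m = position o b
  same : ∀ j → lookup (final o (suc m) ⊕ b) j ≡ lookup (final o m) j
  same j with j Fin.≟ b
  ... | yes refl = trans (lookup∘update b (final o (suc m)) inside) (sym (final-∋ o m ℕₚ.≤-refl))
  ... | no j≢b with m ℕₚ.<? position o j
  ...   | yes m<j = trans (lookup∘update′ j≢b (final o (suc m)) inside)
                      (trans (final-∋ o (suc m) m<j) (sym (final-∋ o m (ℕₚ.<⇒≤ m<j))))
  ...   | no m≮j  = trans (⊕-∌ (final o (suc m)) (final-∌ o (suc m) (ℕ.s≤s j≤m)) j≢b)
                      (sym (final-∌ o m (ℕₚ.≤∧≢⇒< j≤m (j≢b ∘ position-injective o))))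
    where j≤m = ℕₚ.≮⇒≥ m≮j

module _ {n} (i k : Fin n) (k≢i : k ≢ i) where
  -- If `i` came no later than `k` as seen from `next i`, going to `k` by way of `i` would take more
  -- steps than going directly.
  next-interval-∌-start : [ next i , k ] ∌ i
  next-interval-∌-start = interval-∌ (next i) k (ℕₚ.≰⇒> λ p≤q → ℕₚ.<-irrefl refl (begin-strict
    q              <⟨ ℕₚ.n<1+n q ⟩
    suc q          ≡⟨ position-next i k≢i ⟩
    position i k   ≤⟨ ℕₚ.m≤m+n _ p ⟩
    position i k ℕ.+ p ≡⟨ position-rebase-≤ (next i) i k p≤q ⟩
    q              ∎))
    where
    open ≤-Reasoning
    p = position (next i) i
    q = position (next i) k

  next-interval-∌ : ∀ {j} → position i k ℕ.< position i j → [ next i , k ] ∌ j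
  next-interval-∌ {j} lt with j Fin.≟ i
  ... | yes refl = next-interval-∌-start
  ... | no j≢i   = interval-∌ (next i) k
    (ℕₚ.≤-pred (subst₂ ℕ._<_ (sym (position-next i k≢i)) (sym (position-next i j≢i)) lt))

  next-interval-∋ : ∀ {j} → j ≢ i → position i j ℕ.≤ position i k → [ next i , k ] ∋ j
  next-interval-∋ j≢i le = interval-∋ (next i) k
    (ℕₚ.≤-pred (subst₂ ℕ._≤_ (sym (position-next i j≢i)) (sym (position-next i k≢i)) le))

  -- Lets the rank conditions on a decorated permutation be read as statements about `_⊢_`.
  next-interval-⊕ : [ next i , k ] ⊕ i ≡ [ i , k ]
  next-interval-⊕ = subset-ext same
    where
    same : ∀ j → lookup ([ next i , k ] ⊕ i) j ≡ lookup [ i , k ] j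
    same j with j Fin.≟ i
    ... | yes refl = trans (lookup∘update i [ next i , k ] inside)
      (sym (interval-∋ i k (subst (ℕ._≤ position i k) (sym (position-self i)) ℕ.z≤n)))
    ... | no j≢i with position i j ℕₚ.≤? position i k
    ...   | yes le = trans (lookup∘update′ j≢i [ next i , k ] inside)
                       (trans (next-interval-∋ j≢i le) (sym (interval-∋ i k le)))
    ...   | no ≰   = trans (⊕-∌ [ next i , k ] (next-interval-∌ (ℕₚ.≰⇒> ≰)) j≢i)
                       (sym (interval-∌ i k (ℕₚ.≰⇒> ≰)))

-- Arrows

module Arrows {c ℓ} (ℝ : Reals c ℓ) {n} (M : Matroid n) {d} (A : Matrix ℝ d n)
              (hasRank : HasRank ℝ A d) (columnMatroid : IsColumnMatroid ℝ A M)
              (π : Permutation′ n) (decorated : IsDecoratedPermutation M π) where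
  open IsDecoratedPermutation decorated
  open Rank M
  open Representation ℝ M A hasRank columnMatroid

  arrow-⊢ : ∀ i → [ next i , π ⟨$⟩ʳ i ] ⊢ i
  arrow-⊢ i = trans (cong (rk M) (next-interval-⊕ i _ (noFixedPoint i))) (rk-equal i)

  before-arrow-⊬ : ∀ i k → k ≢ i → k <[ i ] (π ⟨$⟩ʳ i) → ¬ [ next i , k ] ⊢ i
  before-arrow-⊬ i k k≢i k<πi ⊢i = first i k k≢i k<πi (trans (cong (rk M) (sym (next-interval-⊕ i k k≢i))) ⊢i)

  -- A downward search, which stops at the latest at the position of `e`, where the final segment
  -- contains `e` itself.
  last-spanning : ∀ x e k → ¬ final x (suc (position x e ℕ.+ k)) ⊢ e →
    ∃[ m ] position x e ℕ.≤ m × m ℕ.≤ position x e ℕ.+ k × final x m ⊢ e × ¬ final x (suc m) ⊢ e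
  last-spanning x e k ⊬e with final x (position x e ℕ.+ k) ⊢? e
  ... | yes ⊢e = position x e ℕ.+ k , ℕₚ.m≤m+n _ k , ℕₚ.≤-refl , ⊢e , ⊬e
  last-spanning x e zero    ⊬e | no ⊬e′ = contradiction
    (∋⇒⊢ (final x (position x e ℕ.+ 0))
      (final-∋ x (position x e ℕ.+ 0) (ℕₚ.≤-reflexive (ℕₚ.+-identityʳ _)))) ⊬e′
  last-spanning x e (suc k) ⊬e | no ⊬e′
    with m , e≤m , m≤k , rest ←
           last-spanning x e k (subst (λ i → ¬ final x i ⊢ e) (ℕₚ.+-suc (position x e) k) ⊬e′) =
    m , e≤m , ℕₚ.≤-trans m≤k (ℕₚ.+-monoʳ-≤ (position x e) (ℕₚ.n≤1+n k)) , rest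

  ArrowCovering : Fin n → Subset n → Set
  ArrowCovering e S = ∃[ I ] CCWArrow π I × e ∈ I × I ⊆ S

  last-spanning⇒covered : ∀ x y e b → position x e ℕ.≤ position x b → position x b ℕ.≤ position x y →
    final x (position x b) ⊢ e → ¬ final x (suc (position x b)) ⊢ e → ArrowCovering e [ x , y ]
  last-spanning⇒covered x y e b e≤b b≤y ⊢e ⊬e =
    [ a , b ] , (a , cong [ a ,_] (sym (inverseˡ π))) , lookup⇒[]= e _ (interval-∋ a b e∈[a,b]) , [a,b]⊆[x,y]
    where
    m = position x b
    C = final x (suc m)
    a = π ⟨$⟩ʳ b
    a≢b = noFixedPoint b

    C⊕b⊢e : C ⊕ b ⊢ e
    C⊕b⊢e = subst (_⊢ e) (sym (final-⊕ x b)) ⊢e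

    C⊬b : ¬ C ⊢ b
    C⊬b C⊢b = ⊬e (⊢-trans C⊢b C⊕b⊢e)

    C⊕e⊢b : C ⊕ e ⊢ b
    C⊕e⊢b = ⊢-exchange C⊕b⊢e ⊬e

    -- Otherwise `[ next b , a ]` lies in `C`, and `C` would span `b`.
    a≤b : position x a ℕ.≤ m
    a≤b = ℕₚ.≮⇒≥ λ b<a → C⊬b (⊢-mono
      (λ j C∌j → outside-arrow b<a j (ℕₚ.≤-pred (∌-final x (suc m) C∌j))) (arrow-⊢ b))
      where
      outside-arrow : m ℕ.< position x a → ∀ j → position x j ℕ.≤ m → [ next b , a ] ∌ j
      outside-arrow b<a j j≤b with j Fin.≟ b
      ... | yes refl = next-interval-∌-start b a a≢b
      ... | no j≢b   = next-interval-∌ b a a≢b (ℕₚ.+-cancelʳ-< m _ _ (begin-strict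
        position b a ℕ.+ m   ≡⟨ position-rebase-≤ x b a (ℕₚ.<⇒≤ b<a) ⟩
        position x a         <⟨ position<n x a ⟩
        n                    ≤⟨ ℕₚ.m≤n+m n _ ⟩
        position x j ℕ.+ n
          ≡⟨ position-rebase-> x b j (ℕₚ.≤∧≢⇒< j≤b (j≢b ∘ position-injective x)) ⟨
        position b j ℕ.+ m   ∎))
        where open ≤-Reasoning

    -- Otherwise `e` precedes `a` in the order from `b`, while `[ next b , e ]` contains `C ⊕ e` and
    -- so spans `b`, although `a` is the first end for which this happens.
    a≤e : position x a ℕ.≤ position x e
    a≤e = ℕₚ.≮⇒≥ λ e<a → before-arrow-⊬ b e (e≢b e<a) (e-before-a e<a) (⊢-mono (spanning e<a) C⊕e⊢b)
      where
      open ≤-Reasoning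
      a<b : position x a ℕ.< m
      a<b = ℕₚ.≤∧≢⇒< a≤b (a≢b ∘ position-injective x)
      module _ (e<a : position x e ℕ.< position x a) where
        e<b = ℕₚ.<-trans e<a a<b
        e≢b : e ≢ b
        e≢b refl = ℕₚ.<-irrefl refl e<b
        e-before-a : e <[ b ] a
        e-before-a = ℕₚ.+-cancelʳ-< m _ _ (begin-strict
          position b e ℕ.+ m   ≡⟨ position-rebase-> x b e e<b ⟩
          position x e ℕ.+ n   <⟨ ℕₚ.+-monoˡ-< n e<a ⟩
          position x a ℕ.+ n   ≡⟨ position-rebase-> x b a a<b ⟨
          position b a ℕ.+ m   ∎)
        spanning : ∀ j → [ next b , e ] ∌ j → C ⊕ e ∌ j
        spanning j ∌j with j Fin.≟ b
        ... | yes refl = ⊕-∌ C (final-∌ x (suc m) ℕₚ.≤-refl) (e≢b ∘ sym)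
        ... | no j≢b with position b j ℕₚ.≤? position b e
        ...   | yes le = contradiction ∌j (∋⇒¬∌ [ next b , e ] (next-interval-∋ b e e≢b j≢b le))
        ...   | no ≰   = ⊕-∌ C (final-∌ x (suc m) (ℕ.s≤s (ℕₚ.≮⇒≥ j≯b))) (λ { refl → ≰ ℕₚ.≤-refl })
          where
          j≯b : ¬ m ℕ.< position x j
          j≯b b<j = ≰ (ℕₚ.+-cancelʳ-≤ m _ _ (begin
            position b j ℕ.+ m   ≡⟨ position-rebase-≤ x b j (ℕₚ.<⇒≤ b<j) ⟩
            position x j         ≤⟨ ℕₚ.<⇒≤ (position<n x j) ⟩
            n                    ≤⟨ ℕₚ.m≤n+m n _ ⟩
            position x e ℕ.+ n   ≡⟨ position-rebase-> x b e e<b ⟨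
            position b e ℕ.+ m   ∎))

    e∈[a,b] : position a e ℕ.≤ position a b
    e∈[a,b] = ℕₚ.+-cancelʳ-≤ (position x a) _ _
      (subst₂ ℕ._≤_ (sym (position-rebase-≤ x a e a≤e)) (sym (position-rebase-≤ x a b a≤b)) e≤b)

    [a,b]⊆[x,y] : [ a , b ] ⊆ [ x , y ]
    [a,b]⊆[x,y] {z} z∈ = lookup⇒[]= z _ (interval-∋ x y (z≤y (ℕₚ.≤-<-connex (position x a) (position x z))))
      where
      z≤y : position x a ℕ.≤ position x z ⊎ position x z ℕ.< position x a → position x z ℕ.≤ position x y
      z≤y (inj₂ z<a) = ℕₚ.≤-trans (ℕₚ.<⇒≤ z<a) (ℕₚ.≤-trans a≤b b≤y)
      z≤y (inj₁ a≤z) = ℕₚ.≤-trans (subst₂ ℕ._≤_ (position-rebase-≤ x a z a≤z) (position-rebase-≤ x a b a≤b)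
        (ℕₚ.+-monoˡ-≤ (position x a) (∋-interval a b ([]=⇒lookup z∈)))) b≤y

  ⊬⇒covered : ∀ x y e → position x e ℕ.≤ position x y → ¬ final x (suc (position x y)) ⊢ e →
              ArrowCovering e [ x , y ]
  ⊬⇒covered x y e e≤y ⊬e
    with m , e≤m , m≤e+k , ⊢e , ⊬e′ ← last-spanning x e (position x y ℕ.∸ position x e)
           (subst (λ i → ¬ final x (suc i) ⊢ e) (sym (ℕₚ.m+[n∸m]≡n e≤y)) ⊬e)
    with m≤y ← ℕₚ.≤-trans m≤e+k (ℕₚ.≤-reflexive (ℕₚ.m+[n∸m]≡n e≤y))
    with b , refl ← position-surjective x (ℕₚ.≤-<-trans m≤y (position<n x y)) =
    last-spanning⇒covered x y e b e≤m m≤y ⊢e ⊬e′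

  module _ (y : Fin n) where
    private
      x = π ⟨$⟩ʳ y
      C = final x (suc (position x y))
      x≢y = noFixedPoint y
      x-position : position y x ℕ.+ position x y ≡ n
      x-position = trans
        (position-rebase-> x y x
          (subst (ℕ._< position x y) (sym (position-self x)) (position-pos x (x≢y ∘ sym))))
        (cong (ℕ._+ n) (position-self x))
      suc-pred : ∀ {k m} → k ℕ.< m → suc (ℕ.pred m) ≡ m
      suc-pred (ℕ.s≤s _) = refl

    -- `C ⊕ x` contains `[ next y , x ]`, which spans `y` by the definition of the arrow.
    complement⊕start⊢end : C ⊕ x ⊢ y
    complement⊕start⊢end = ⊢-mono outside-arrow (arrow-⊢ y)
      where
      outside-arrow : ∀ j → C ⊕ x ∌ j → [ next y , x ] ∌ j
      outside-arrow j ∌j with j Fin.≟ y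
      ... | yes refl = next-interval-∌-start y x x≢y
      ... | no j≢y   = next-interval-∌ y x x≢y (ℕₚ.+-cancelʳ-< (position x y) _ _ (begin-strict
        position y x ℕ.+ position x y  ≡⟨ x-position ⟩
        n                              <⟨ ℕₚ.+-monoˡ-< n (position-pos x (∌-⊕-≢ C ∌j)) ⟩
        position x j ℕ.+ n             ≡⟨ position-rebase-> x y j
          (ℕₚ.≤∧≢⇒< (ℕₚ.≤-pred (∌-final x _ (∌-⊕ C ∌j))) (j≢y ∘ position-injective x)) ⟨
        position y j ℕ.+ position x y  ∎))
        where open ≤-Reasoning

    -- The hypothesis makes `C` nonempty. Its last element `k`, just before `x`, precedes `x` in the
    -- order from `y`, and `C` lies in `[ next y , k ]`, which therefore does not span `y`.
    complement⊬end : suc (position x y) ℕ.< n → ¬ C ⊢ y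
    complement⊬end y+1<n C⊢y
      with k , k-last ← position-surjective x {ℕ.pred n} (ℕₚ.≤-reflexive (suc-pred y+1<n)) =
      before-arrow-⊬ y k k≢y k<x (⊢-mono outside-complement C⊢y)
      where
      suc-k : suc (position x k) ≡ n
      suc-k = trans (cong suc k-last) (suc-pred y+1<n)
      y<k : position x y ℕ.< position x k
      y<k = ℕₚ.≤-pred (subst (suc (position x y) ℕ.<_) (sym suc-k) y+1<n)
      k≢y : k ≢ y
      k≢y refl = ℕₚ.<-irrefl refl y<k
      k-position : position y k ℕ.+ position x y ≡ position x k
      k-position = position-rebase-≤ x y k (ℕₚ.<⇒≤ y<k)
      k<x : k <[ y ] x
      k<x = ℕₚ.+-cancelʳ-< (position x y) _ _
        (subst₂ ℕ._<_ (sym k-position) (sym x-position) (position<n x k))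
      outside-complement : ∀ j → [ next y , k ] ∌ j → C ∌ j
      outside-complement j ∌j with j Fin.≟ y
      ... | yes refl = final-∌ x _ ℕₚ.≤-refl
      ... | no j≢y   = final-∌ x _ (ℕ.s≤s (ℕₚ.≮⇒≥ λ y<j → ∋⇒¬∌ [ next y , k ] (next-interval-∋ y k k≢y j≢y
        (ℕₚ.+-cancelʳ-≤ (position x y) _ _ (subst₂ ℕ._≤_
          (sym (position-rebase-≤ x y j (ℕₚ.<⇒≤ y<j))) (sym k-position)
          (ℕₚ.≤-pred (subst (position x j ℕ.<_) (sym suc-k) (position<n x j)))))) ∌j))

module PositroidArrows {c ℓ} (ℝ : Reals c ℓ) {n} (M : Matroid n) (loopless : Loopless M)
                       {d} (A : Matrix ℝ d n)
                       (hasRank : HasRank ℝ A d) (columnMatroid : IsColumnMatroid ℝ A M)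
                       (nonnegative : NonnegativeMaximalMinors ℝ A)
                       (π : Permutation′ n) (decorated : IsDecoratedPermutation M π) where
  open IsDecoratedPermutation decorated using (noFixedPoint)
  open Rank M
  open Arrows ℝ M A hasRank columnMatroid π decorated
  open Positroid ℝ M A hasRank columnMatroid nonnegative

  -- For `e` strictly inside the arrow, every chord from `e` to the complement crosses the chord of
  -- `x` and `y`, so `noncrossing` applies; the two ends follow from the rank conditions at `y`.
  complement-flat : ∀ y {e} → let x = π ⟨$⟩ʳ y in suc (position x y) ℕ.< n →
    position x e ℕ.≤ position x y → ¬ final x (suc (position x y)) ⊢ e
  complement-flat y {e} y+1<n e≤y C⊢e with e Fin.≟ y | e Fin.≟ (π ⟨$⟩ʳ y)
  ... | yes refl | _        = complement⊬end y y+1<n C⊢e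
  ... | no _     | yes refl = complement⊬end y y+1<n (⊢-trans C⊢e (complement⊕start⊢end y))
  ... | no e≢y   | no e≢x   = noncrossing
    (final-∌ x m (ℕ.s≤s (subst (ℕ._≤ position x y) (sym (position-self x)) ℕ.z≤n)))
    (final-∌ x m ℕₚ.≤-refl) (final-∌ x m (ℕ.s≤s e≤y)) (noFixedPoint y ∘ sym) e≢x e≢y
    (complement⊬end y y+1<n) (complement⊕start⊢end y) (loopless e)
    (λ f C∋f → crossing x e≢x (ℕₚ.≤∧≢⇒< e≤y (e≢y ∘ position-injective x)) (∋-final x m C∋f)) C⊢e
    where
    x = π ⟨$⟩ʳ y
    m = suc (position x y)

-- Concordance and covering by arrows

open import Data.Nat.Base using (_<_)

module _ {c ℓ} (ℝ : Reals c ℓ) {n : ℕ} (Mπ Mμ : Matroid n) where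
  open Rank using (_⊢_)

  concordant-⊢ : (rk< : rank Mμ < rank Mπ) → Concordant ℝ Mμ Mπ rk< →
                 ∀ {C e} → C ∌ e → _⊢_ Mπ C e → _⊢_ Mμ C e
  concordant-⊢ rk< (A , hasRank , columns , hasRank₀ , columns₀) {C} {e} C∌e C⊢e =
    decidable-stable (Rank._⊢?_ Mμ C e) λ C⊬e →
      Representation.⊢⇒¬¬Spans ℝ Mπ A hasRank columns C∌e C⊢e λ (t , t⊥A , te≉0 , supp) →
        C⊬e (Representation.spans⇒⊢ ℝ Mμ (firstRows ℝ (ℕₚ.<⇒≤ rk<) A) hasRank₀ columns₀ C∌e
          (t , (λ i → t⊥A (Fin.inject≤ i (ℕₚ.<⇒≤ rk<))) , te≉0 , supp))

proposition6p2 : ∀ {c ℓ : Level} (ℝ : Reals c ℓ) {n : ℕ} (Mπ Mμ : Matroid n) (π μ : Permutation′ n) →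
    IsPositroid ℝ Mπ → Loopless Mπ → Coloopless Mπ → IsDecoratedPermutation Mπ π →
    IsPositroid ℝ Mμ → Loopless Mμ → Coloopless Mμ → IsDecoratedPermutation Mμ μ →
    (rk< : rank Mμ < rank Mπ) → Concordant ℝ Mμ Mπ rk< →
    ∀ (S : Subset n) → CCWArrow μ S → CoveredByCCWArrows π S
proposition6p2 ℝ {n} Mπ Mμ π μ _ _ _ decoratedπ (Aμ , hasRankμ , nonnegative , columnsμ) loopless _ decoratedμ
  rk< concordant@(A , hasRank , columns , _) S (x₀ , S≡[x₀,y]) e e∈S =
  subst (ArrowCovering e) (sym S≡[x,y]) covered
  where
  open Arrows ℝ Mπ A hasRank columns π decoratedπ using (ArrowCovering; ⊬⇒covered)
  open PositroidArrows ℝ Mμ loopless Aμ hasRankμ columnsμ nonnegative μ decoratedμ using (complement-flat)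
  -- The arrow is indexed by its end `y`, as in the lemmas on arrows; its start `x` equals `x₀` only
  -- up to a proof.
  y = μ ⟨$⟩ˡ x₀
  x = μ ⟨$⟩ʳ y

  S≡[x,y] : S ≡ [ x , y ]
  S≡[x,y] = trans S≡[x₀,y] (cong [_, y ] (sym (inverseʳ μ)))

  e≤y : position x e ℕ.≤ position x y
  e≤y = ∋-interval x y ([]=⇒lookup (subst (e ∈_) S≡[x,y] e∈S))

  covered : ArrowCovering e [ x , y ]
  covered with suc (position x y) ℕₚ.<? n
  -- `complement-flat` works with a nonnegative matrix of `Mμ`, `concordant-⊢` with the first rows
  -- of `A`. These may differ, but `_⊢_` depends only on the matroid and so links them.
  ... | yes y+1<n = ⊬⇒covered x y e e≤y λ C⊢e → complement-flat y y+1<n e≤y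
    (concordant-⊢ ℝ Mπ Mμ rk< concordant (final-∌ x _ (ℕ.s≤s e≤y)) C⊢e)
  -- Here `[ x , y ]` is the whole ground set, so any arrow of `π` through `e` will do.
  ... | no  y+1≮n = [ e , π ⟨$⟩ˡ e ] , (e , refl)
    , lookup⇒[]= e _ (interval-∋ e _ (subst (ℕ._≤ position e (π ⟨$⟩ˡ e)) (sym (position-self e)) ℕ.z≤n))
    , λ {z} _ → lookup⇒[]= z _ (interval-∋ x y (ℕₚ.≤-pred (ℕₚ.≤-trans (position<n x z) (ℕₚ.≮⇒≥ y+1≮n))))
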